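{- In the worst case, $\Omega(\sigma\, z_{no}\log_\sigma n)$ substring queries are necessary to reconstruct a string of length $n$ over an alphabet of size $\sigma$: for any adaptive reconstruction algorithm there are strings $S$ of length $n$ on which it asks $\Omega(\sigma\, z_{no}(S)\log_\sigma n)$ substring queries.
   Context: A substring oracle knows the hidden string $S$ and answers queries of the form "Is $s$ a substring of $S$?" with yes/no; an adaptive reconstruction algorithm chooses queries depending on previous answers and must determine $S$ exactly. $z_{no}(S)$ is the number of phrases of the Lempel–Ziv 1977 factorization of $S$ without overlaps: $S$ is parsed left to right into phrases, where each new phrase is either a single character not occurring earlier in $S$, or the longest string starting at the current position that also occurs in $S$ at an earlier starting position with that earlier occurrence not overlapping the phrase itself.
   Formalization: The alphabet size σ is assumed to satisfy 2 ≤ σ ≤ n; the bound with a uniform constant fails when σ is much larger than n (e.g. n = √σ, where O(σ) queries suffice while z_no is unbounded), and log_σ needs σ ≥ 2. -}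

module Defs where

open import Data.Bool.Base using (Bool)
open import Data.Fin.Base using (Fin)
import Data.Fin.Properties as Fin
open import Data.List.Base
  using (List; []; _∷_; [_]; _++_; length; inits; filter; drop)
open import Data.List.Extrema.Nat using (argmax)
open import Data.List.Relation.Binary.Infix.Heterogeneous using (Infix)
open import Data.List.Relation.Binary.Infix.Heterogeneous.Properties using (infix?)
open import Data.Nat.Base using (ℕ; zero; suc; _≤_; _^_)
open import Relation.Binary.PropositionalEquality using (_≡_)
open import Relation.Nullary.Decidable using (Dec; does)

String : ℕ → Set
String σ = List (Fin σ)

_SubstringOf_ : ∀ {σ} → String σ → String σ → Set
_SubstringOf_ = Infix _≡_

_substringOf?_ : ∀ {σ} (s S : String σ) → Dec (s SubstringOf S)
_substringOf?_ = infix? Fin._≟_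

-- A deterministic adaptive algorithm is a decision tree: the next query
-- (or the output) may depend on all previous answers.
data Algorithm (σ : ℕ) : Set where
  output : String σ → Algorithm σ
  ask    : String σ → (Bool → Algorithm σ) → Algorithm σ

result : ∀ {σ} → Algorithm σ → String σ → String σ
result (output T) S = T
result (ask s k)  S = result (k (does (s substringOf? S))) S

queries : ∀ {σ} → Algorithm σ → String σ → ℕ
queries (output T) S = 0
queries (ask s k)  S = suc (queries (k (does (s substringOf? S))) S)

-- The length n is known to the algorithm, which only has to be correct on
-- strings of that length.
Reconstructs : ∀ {σ} → Algorithm σ → ℕ → Set
Reconstructs {σ} A n = (S : String σ) → length S ≡ n → result A S ≡ S

-- An occurrence of a phrase that starts earlier and does not overlap the
-- phrase is exactly an occurrence inside the part `past` already parsed.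
longestCopy : ∀ {σ} → String σ → String σ → String σ
longestCopy past rest =
  argmax length [] (filter (_substringOf? past) (inits rest))

nextPhrase : ∀ {σ} → String σ → Fin σ → String σ → String σ
nextPhrase past c rest with longestCopy past (c ∷ rest)
... | []    = [ c ]
... | d ∷ w = d ∷ w

-- The first argument is fuel; phrases are nonempty, so length rest suffices.
factorsFrom : ∀ {σ} → ℕ → String σ → String σ → List (String σ)
factorsFrom zero       past rest       = []
factorsFrom (suc fuel) past []         = []
factorsFrom (suc fuel) past (c ∷ rest) =
  let f = nextPhrase past c rest
  in  f ∷ factorsFrom fuel (past ++ f) (drop (length f) (c ∷ rest))

LZ77-no : ∀ {σ} → String σ → List (String σ)
LZ77-no S = factorsFrom (length S) [] S

z-no : ∀ {σ} → String σ → ℕ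
z-no S = length (LZ77-no S)

-- k *log⟨ b ⟩ m ≼ t  is the real inequality  k · log_b m ≤ t  (b ≥ 2, m ≥ 1),
-- exponentiated to base b.
_*log⟨_⟩_≼_ : ℕ → ℕ → ℕ → ℕ → Set
k *log⟨ b ⟩ m ≼ t = m ^ k ≤ b ^ t

-- The hard strings start with a dictionary containing all words of length
-- L = Θ(log_σ n), so that each later run of L hidden letters is a copy, costing
-- O(1) phrases.  For bounded σ (here σ ≤ 16) everything after the dictionary is
-- hidden, and an answer at best halves the set of candidates.
--
-- For large σ, let γ = Θ(σ).  There are γM = Θ(√(γn)) blocks  c aⁱ w aⁱ c,  where
-- the pair (c , i) names the block and w is its hidden word over γ letters.
-- A substring that meets w and also a mark c can occur only at this block; one
-- that meets no mark lies in the dictionary, which contains a^M w a^M for all w.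
-- Hence a query that is not answered in advance tests hidden letters at a single
-- site, and the adversary refutes it by excluding one letter at one position.
-- Each of the γML positions requires γ − 1 exclusions, which gives
-- γML(γ − 1) = Ω(σ z log_σ n) queries.
module Submission where

open import Defs
open import Data.Bool.Base using (true; false)
open import Data.Empty using (⊥-elim)
open import Data.Fin.Base
  using (Fin; zero; suc; toℕ; fromℕ<; inject≤; combine; join; splitAt; punchIn;
         finToFun; funToFin)
import Data.Fin.Properties as Fin
open import Data.List.Base hiding (lookup; splitAt)
import Data.List.Base as List
open import Data.List.Extrema.Nat using (argmax-all; f[xs]≤f[argmax])
open import Data.List.Membership.Propositional using (_∈_)
open import Data.List.Membership.Propositional.Properties
open import Data.List.Properties
open import Data.List.Relation.Binary.Infix.Heterogeneous
  using (Infix; toView; fromView; MkView; _++ⁱ_; _ⁱ++_)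
import Data.List.Relation.Binary.Infix.Heterogeneous as InfixBase
import Data.List.Relation.Binary.Infix.Heterogeneous.Properties as Infix
open import Data.List.Relation.Binary.Pointwise using (Pointwise-≡⇒≡; ≡⇒Pointwise-≡)
open import Data.List.Relation.Unary.All as All using (All; []; _∷_)
import Data.List.Relation.Unary.All.Properties as All
open import Data.List.Relation.Unary.AllPairs using ([]; _∷_)
open import Data.List.Relation.Unary.Any using (here; there)
import Data.List.Relation.Unary.Any.Properties as Any
open import Data.List.Relation.Unary.Unique.Propositional using (Unique)
import Data.List.Relation.Unary.Unique.Propositional.Properties as Unique
open import Data.Nat.Base
open import Data.Nat.DivMod using (m≡m%n+[m/n]*n; m%n<n; m/n*n≤m; /-monoˡ-≤)
open import Data.Nat.Properties
open import Data.Nat.Tactic.RingSolver using (solve-∀)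
open import Data.Product.Base using (∃; ∃-syntax; _×_; _,_; proj₁; proj₂)
open import Data.Sum.Base using (_⊎_; inj₁; inj₂; [_,_]′)
open import Data.Unit.Base using (⊤)
open import Data.Vec.Base as Vec using (Vec; []; _∷_; lookup; _[_]≔_)
open import Data.Vec.Functional as VecF using (Vector)
open import Data.Vec.Functional.Properties using (updateAt-updates; updateAt-minimal)
open import Data.Vec.Properties using (lookup∘tabulate; lookup∘update; lookup∘update′)
open import Function.Base using (_∘_; const; id)
open import Function.Definitions using (Injective)
open import Relation.Binary.Definitions using (DecidableEquality)
open import Relation.Binary.PropositionalEquality hiding ([_])
open import Relation.Nullary using (¬_; Dec; yes; no)
open import Relation.Nullary.Decidable
  using (_×-dec_; ¬?; map′; decidable-stable; dec-true; dec-false)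
open import Relation.Unary using (Pred; Decidable)

-- Why two regimes: counting can exploit only one bit per answer and falls short of the factor `σ`
-- by an amount that grows with `σ`, while excluding letters one at a time needs marks and a pad
-- besides the hidden letters, hence enough spare alphabet. Why a block needs a two-part name: the
-- dictionary costs about `γ ^ L * L` phrases. These must not dominate `z`, so there must be about
-- as many blocks as dictionary phrases, divided by `γ`, times `γ` again: of order `γ M` with
-- `γ ^ (L - 1) * L ≤ M`. The `γ` marks alone cannot name that many blocks, and the gap multiplies
-- the supply by `M`. The price is blocks and dictionary entries of length of order `M`, whence `n`
-- is of order `γ M²`. The obstacle is that a query can leave a hidden word on either side and run
-- into the dictionary or a neighbouring block. Hence each block carries its name on both sides,
-- each closing mark is followed at once by the next opening mark, and the dictionary ends in a run
-- of pads longer than every gap.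

private variable
  σ n : ℕ
  A B C H K P : Set

-- Greedy parsing is optimal

infix⁺ : ∀ (x s y : List A) → Infix _≡_ s (x ++ s ++ y)
infix⁺ x s y = fromView (MkView x (≡⇒Pointwise-≡ refl) y)

infix⁻ : ∀ {s t : List A} → Infix _≡_ s t → ∃[ x ] ∃[ y ] t ≡ x ++ s ++ y
infix⁻ s⊂t with MkView x s≈ y ← toView s⊂t with refl ← Pointwise-≡⇒≡ s≈ =
  x , y , refl

infix-reflexive : ∀ {s t : List A} → s ≡ t → Infix _≡_ s t
infix-reflexive = Infix.fromPointwise ∘ ≡⇒Pointwise-≡

infix-trans : ∀ {s t u : List A} → Infix _≡_ s t → Infix _≡_ t u → Infix _≡_ s u
infix-trans = Infix.trans trans

infix-map : ∀ (f : A → B) {s t} → Infix _≡_ s t → Infix _≡_ (map f s) (map f t)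
infix-map f s⊂t = Infix.map⁺ f f (InfixBase.map (cong f) s⊂t)

++-compare : ∀ (w r u v : List A) → w ++ r ≡ u ++ v →
  (∃[ e ] w ≡ u ++ e × v ≡ e ++ r) ⊎ (∃[ e ] u ≡ w ++ e × r ≡ e ++ v)
++-compare w       r []      v eq = inj₁ (w , refl , sym eq)
++-compare []      r (x ∷ u) v eq = inj₂ (x ∷ u , refl , eq)
++-compare (y ∷ w) r (x ∷ u) v eq with ∷-injective eq
... | refl , eq′ with ++-compare w r u v eq′
...   | inj₁ (e , refl , q) = inj₁ (e , refl , q)
...   | inj₂ (e , refl , q) = inj₂ (e , refl , q)

map-++⁻ : ∀ (f : A → B) w X {Y} → map f w ≡ X ++ Y →
  ∃[ u ] ∃[ v ] w ≡ u ++ v × X ≡ map f u × Y ≡ map f v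
map-++⁻ f w       []      refl = [] , w , refl , refl , refl
map-++⁻ f (a ∷ w) (x ∷ X) eq with refl , eq′ ← ∷-injective eq
  with u , v , refl , refl , refl ← map-++⁻ f w X eq′ = a ∷ u , v , refl , refl , refl

infix-map⁻ : ∀ (f : A → B) t {s} → Infix _≡_ s (map f t) → ∃[ u ] s ≡ map f u × Infix _≡_ u t
infix-map⁻ f t {s} s⊂ with X , Y , eq ← infix⁻ s⊂
  with x , v , refl , _ , v≡ ← map-++⁻ f t X eq
  with u , y , refl , s≡ , _ ← map-++⁻ f v s (sym v≡) = u , s≡ , infix⁺ x u y

-- The index k is an upper bound on the number of pieces.
data Parse {A : Set} (past : List A) : List A → ℕ → Set where
  done    : ∀ {k} → Parse past [] k
  literal : ∀ {c rest k} → Parse (past ++ [ c ]) rest k →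
            Parse past (c ∷ rest) (suc k)
  copy    : ∀ w {rest k} → Infix _≡_ w past → Parse (past ++ w) rest k →
            Parse past (w ++ rest) (suc k)

Parse-weaken : ∀ {past rest : List A} {j k} → j ≤ k → Parse past rest j → Parse past rest k
Parse-weaken _       done           = done
Parse-weaken (s≤s l) (literal p)    = literal (Parse-weaken l p)
Parse-weaken (s≤s l) (copy w w⊂ p)  = copy w w⊂ (Parse-weaken l p)

Parse-++ : ∀ {past u v : List A} {j k} → Parse past u j → Parse (past ++ u) v k →
           Parse past (u ++ v) (j + k)
Parse-++ {past = past} {j = j} {k} done q = Parse-weaken (m≤n+m k j)
  (subst (λ x → Parse x _ _) (++-identityʳ past) q)
Parse-++ {past = past} (literal {c} {r} p) q = literal (Parse-++ p
  (subst (λ x → Parse x _ _) (sym (++-assoc past [ c ] r)) q))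
Parse-++ {past = past} {v = v} (copy w {r} w⊂ p) q
  rewrite ++-assoc w r v = copy w w⊂ (Parse-++ p
    (subst (λ x → Parse x _ _) (sym (++-assoc past w r)) q))

Parse-literals : ∀ {past : List A} u → Parse past u (length u)
Parse-literals []      = done
Parse-literals (c ∷ u) = literal (Parse-literals u)

Parse-copy : ∀ {past w : List A} → Infix _≡_ w past → Parse past w 1
Parse-copy {past = past} {w} w⊂ =
  subst (λ x → Parse past x 1) (++-identityʳ w) (copy w w⊂ done)

-- `Q` limits the words that need a source: any word over a small alphabet, only runs of pads in the
-- filler of the large one. Empty copies are legal pieces, so exactly `k` chunks may be cut even if
-- `u` ends early.
Parse-chunks : ∀ {p} {Q : Pred A p} {past m} →
  (∀ w → All Q w → length w ≤ m → Infix _≡_ w past) →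
  ∀ k u → All Q u → length u ≤ k * m → Parse past u k
Parse-chunks copies zero [] qs len = done
Parse-chunks {past = past} {m} copies (suc k) u qs len =
  subst (λ x → Parse past x (suc k)) (take++drop≡id m u)
    (copy (take m u)
      (copies (take m u) (All.take⁺ m qs)
        (≤-trans (≤-reflexive (length-take m u)) (m⊓n≤m m (length u))))
      (Parse-chunks (λ w qs l → copies w qs l ⁱ++ take m u) k (drop m u)
        (All.drop⁺ m qs) rest≤))
  where
  rest≤ : length (drop m u) ≤ k * m
  rest≤ rewrite length-drop m u = ≤-trans (∸-monoˡ-≤ m len) (≤-reflexive (m+n∸m≡n m (k * m)))

-- Pieces inside `u` are dropped. A piece straddling the cut must be a copy, and what remains of it
-- is a suffix of the copied word, hence still occurs in the past.
Parse-suffix : ∀ {past : List A} {k} u {v} → Parse past (u ++ v) k → Parse (past ++ u) v k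
Parse-suffix u p = go u p refl
  where
  go : ∀ {past t : List A} {k} u {v} → Parse past t k → t ≡ u ++ v → Parse (past ++ u) v k
  go {past = past} [] p refl = subst (λ x → Parse x _ _) (sym (++-identityʳ past)) p
  go (x ∷ u) done ()
  go {past = past} (x ∷ u) (literal {c} p) eq with refl , eq′ ← ∷-injective eq =
    Parse-weaken (n≤1+n _) (subst (λ y → Parse y _ _) (++-assoc past [ x ] u) (go u p eq′))
  go {past = past} (x ∷ u) {v} (copy w {r} w⊂ p) eq with ++-compare w r (x ∷ u) v eq
  ... | inj₁ (e , refl , refl) = copy e
          (infix-trans ((x ∷ u) ++ⁱ infix-reflexive refl) w⊂ ⁱ++ (x ∷ u))
          (subst (λ y → Parse y r _) (sym (++-assoc past (x ∷ u) e)) p)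
  ... | inj₂ (e , eq′ , refl) rewrite eq′ = Parse-weaken (n≤1+n _)
          (subst (λ y → Parse y v _) (++-assoc past w e) (go e p refl))

-- The image of an occurrence is an occurrence, so this holds for any `f`; a parse is only an upper
-- bound on the number of phrases.
Parse-map : ∀ (f : A → B) {past u k} → Parse past u k → Parse (map f past) (map f u) k
Parse-map f done = done
Parse-map f {past} (literal {c} p) =
  literal (subst (λ t → Parse t _ _) (map-++ f past [ c ]) (Parse-map f p))
Parse-map f {past} (copy w {rest} w⊂ p) =
  subst (λ t → Parse (map f past) t _) (sym (map-++ f w rest))
    (copy (map f w) (infix-map f w⊂) (subst (λ t → Parse t _ _) (map-++ f past w) (Parse-map f p)))

longestCopy-prefix : ∀ (past rest : String σ) → ∃[ v ] rest ≡ longestCopy past rest ++ v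
longestCopy-prefix past rest = argmax-all length {P = λ w → ∃[ v ] rest ≡ w ++ v}
  (rest , refl) (All.filter⁺ (_substringOf? past) (inits-prefix rest))
  where
  inits-prefix : ∀ (t : List A) → All (λ w → ∃[ v ] t ≡ w ++ v) (inits t)
  inits-prefix []      = ([] , refl) ∷ []
  inits-prefix (x ∷ t) = (x ∷ t , refl) ∷ All.map⁺ (All.map
    (λ { (v , eq) → v , cong (x ∷_) eq }) (inits-prefix t))

longestCopy-longest : ∀ (past w rest : String σ) → w SubstringOf past →
  length w ≤ length (longestCopy past (w ++ rest))
longestCopy-longest past w rest w⊂ =
  All.lookup (f[xs]≤f[argmax] {f = length} [] _) (∈-filter⁺ (_substringOf? past) (∈-inits w) w⊂)
  where
  ∈-inits : ∀ w → w ∈ inits (w ++ rest)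
  ∈-inits []      = here refl
  ∈-inits (c ∷ w) = there (∈-map⁺ (c ∷_) (∈-inits w))

record IsNextPhrase {σ} (past : String σ) (c : Fin σ) (rest f : String σ) : Set where
  field
    nonempty : 1 ≤ length f
    prefix   : ∃[ v ] c ∷ rest ≡ f ++ v
    longest  : ∀ w v → w SubstringOf past → c ∷ rest ≡ w ++ v → length w ≤ length f

nextPhrase-spec : ∀ (past : String σ) c rest →
  IsNextPhrase past c rest (nextPhrase past c rest)
nextPhrase-spec past c rest
  with longestCopy past (c ∷ rest) in eq | longestCopy-prefix past (c ∷ rest)
-- An empty longest copy means that every copyable prefix is empty, so the fallback `[ c ]` is at
-- least as long as all of them.
... | []    | _ = record
  { nonempty = s≤s z≤n
  ; prefix   = rest , refl
  ; longest  = λ w v w⊂ split → ≤-trans (longest w v w⊂ split) z≤n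
  }
  where
  longest : ∀ w v → w SubstringOf past → c ∷ rest ≡ w ++ v → length w ≤ 0
  longest w v w⊂ split = subst (λ x → length w ≤ length x)
    (trans (cong (longestCopy past) (sym split)) eq) (longestCopy-longest past w v w⊂)
... | d ∷ f | pre = record
  { nonempty = s≤s z≤n
  ; prefix   = pre
  ; longest  = λ w v w⊂ split → subst (λ x → length w ≤ length x)
      (trans (cong (longestCopy past) (sym split)) eq) (longestCopy-longest past w v w⊂)
  }

drop-++ : ∀ (u v : List A) → drop (length u) (u ++ v) ≡ v
drop-++ []      v = refl
drop-++ (x ∷ u) v = drop-++ u v

++-extends : ∀ (w r f v : List A) → length w ≤ length f → w ++ r ≡ f ++ v →
  ∃[ e ] f ≡ w ++ e × r ≡ e ++ v
++-extends []      r f       v _       eq = f , refl , eq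
++-extends (x ∷ w) r (y ∷ f) v (s≤s l) eq with refl , eq′ ← ∷-injective eq
  with e , refl , q ← ++-extends w r f v l eq′ = e , refl , q

-- An exchange argument: the greedy phrase is at least as long as the first piece `w` of any parse,
-- so it is `w ++ e`, and `Parse-suffix` removes `e` from the rest of that parse without adding a
-- piece.
greedy-optimal : ∀ fuel (past : String σ) rest {k} → Parse past rest k →
  length (factorsFrom fuel past rest) ≤ k
greedy-optimal zero       past rest       p = z≤n
greedy-optimal (suc fuel) past []         p = z≤n
greedy-optimal (suc fuel) past (c ∷ rest) {k} p = step p refl
  where
  f = nextPhrase past c rest
  open IsNextPhrase (nextPhrase-spec past c rest)
  tail-parse : ∀ {k} v → c ∷ rest ≡ f ++ v → Parse (past ++ f) v k →
    suc (length (factorsFrom fuel (past ++ f) (drop (length f) (c ∷ rest)))) ≤ suc k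
  tail-parse v eq q = s≤s (greedy-optimal fuel _ _
    (subst (λ x → Parse (past ++ f) x _)
      (sym (trans (cong (drop (length f)) eq) (drop-++ f v))) q))
  first-piece : ∀ w r {k} → length w ≤ length f → c ∷ rest ≡ w ++ r → Parse (past ++ w) r k →
    suc (length (factorsFrom fuel (past ++ f) (drop (length f) (c ∷ rest)))) ≤ suc k
  first-piece w r l eq q with v , eq′ ← prefix
    with e , f≡ , refl ← ++-extends w r f v l (trans (sym eq) eq′) =
    tail-parse v eq′ (subst (λ x → Parse x v _)
      (trans (++-assoc past w e) (cong (past ++_) (sym f≡))) (Parse-suffix e q))
  step : ∀ {t k} → Parse past t k → c ∷ rest ≡ t →
    suc (length (factorsFrom fuel (past ++ f) (drop (length f) (c ∷ rest)))) ≤ k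
  step (literal q)   refl = first-piece [ c ] rest nonempty refl q
  step (copy w w⊂ q) eq   = first-piece w _ (longest w _ w⊂ eq) eq q

z-no≤ : ∀ {S : String σ} {k} → Parse [] S k → z-no S ≤ k
z-no≤ {S = S} = greedy-optimal (length S) [] S

-- The adversary

ask-yes : ∀ {σ} {s S : String σ} k → s SubstringOf S →
  result (ask s k) S ≡ result (k true) S ×
  queries (ask s k) S ≡ suc (queries (k true) S)
ask-yes {s = s} {S} k s⊂ rewrite dec-true (s substringOf? S) s⊂ = refl , refl

ask-no : ∀ {σ} {s S : String σ} k → ¬ s SubstringOf S →
  result (ask s k) S ≡ result (k false) S ×
  queries (ask s k) S ≡ suc (queries (k false) S)
ask-no {s = s} {S} k s⊄ rewrite dec-false (s substringOf? S) s⊄ = refl , refl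

∑ : ∀ {P} → Vector ℕ P → ℕ
∑ = VecF.foldr _+_ 0

∑-mono : ∀ {P} {f g : Vector ℕ P} → (∀ p → f p ≤ g p) → ∑ f ≤ ∑ g
∑-mono {zero}  le = z≤n
∑-mono {suc P} le = +-mono-≤ (le zero) (∑-mono (le ∘ suc))

∑-const : ∀ P k → ∑ {P} (const k) ≡ P * k
∑-const zero    k = refl
∑-const (suc P) k = cong (k +_) (∑-const P k)

∑-decrement : ∀ {P} {f g : Vector ℕ P} p → f p ≤ suc (g p) →
  (∀ q → q ≢ p → f q ≤ g q) → ∑ f ≤ suc (∑ g)
∑-decrement zero    fp≤ rest =
  +-mono-≤ fp≤ (∑-mono λ q → rest (suc q) λ ())
∑-decrement {g = g} (suc p) fp≤ rest = ≤-trans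
  (+-mono-≤ (rest zero λ ())
    (∑-decrement p fp≤ λ q q≢p → rest (suc q) (q≢p ∘ Fin.suc-injective)))
  (≤-reflexive (+-suc (g zero) _))

-- The adversary branches on whether a query is already settled on its box; this finite search makes
-- the case distinction constructive.
anyVec? : ∀ {γ P p} {Q : Pred (Vec (Fin γ) P) p} → Decidable Q → Dec (∃ Q)
anyVec? {P = zero}  Q? = map′ ([] ,_) (λ { ([] , q) → q }) (Q? [])
anyVec? {P = suc P} Q? = map′
  (λ { (x , v , q) → x ∷ v , q }) (λ { (x ∷ v , q) → x , v , q })
  (Fin.any? λ x → anyVec? λ v → Q? (x ∷ v))

-- A nonempty set of letters, given by an injective enumeration. Storing the size minus one makes it
-- nonempty by construction and makes `extra` the number of letters that can still be excluded.
record Choices (γ : ℕ) : Set where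
  field
    extra     : ℕ
    letter    : Fin (suc extra) → Fin γ
    injective : Injective _≡_ _≡_ letter

  Allowed : Fin γ → Set
  Allowed d = ∃[ j ] letter j ≡ d

open Choices

-- A second allowed letter `d` guarantees that something is left after `e` goes; `punchIn j`
-- enumerates the rest by skipping the index of `e`.
remove : ∀ {γ} (C : Choices γ) {d e} → Allowed C d → Allowed C e → d ≢ e →
  ∃[ C′ ] extra C ≡ suc (extra C′) ×
    (∀ {x} → Allowed C′ x → Allowed C x × x ≢ e)
remove record { extra = zero } (zero , p) (zero , q) d≢e =
  ⊥-elim (d≢e (trans (sym p) q))
remove C@record { extra = suc k } (i , refl) (j , refl) d≢e = C′ , refl ,
  λ { (l , refl) → (punchIn j l , refl) , Fin.punchInᵢ≢i j l ∘ injective C }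
  where
  C′ : Choices _
  C′ = record
    { extra     = k
    ; letter    = letter C ∘ punchIn j
    ; injective = Fin.punchIn-injective j _ _ ∘ injective C
    }

one-choice : ∀ {γ} (C : Choices γ) →
  (∀ {d e} → Allowed C d → Allowed C e → d ≡ e) → extra C ≤ 0
one-choice record { extra = zero } _ = z≤n
one-choice C@record { extra = suc _ } same
  with () ← injective C {zero} {suc zero} (same (zero , refl) (suc zero , refl))

Box : ℕ → ℕ → Set
Box γ P = Vector (Choices γ) P

_∈ᴮ_ : ∀ {γ P} → Vec (Fin γ) P → Box γ P → Set
v ∈ᴮ B = ∀ p → Allowed (B p) (lookup v p)

_∈ᴮ?_ : ∀ {γ P} (v : Vec (Fin γ) P) (B : Box γ P) → Dec (v ∈ᴮ B)
v ∈ᴮ? B = Fin.all? λ p → Fin.any? λ j → letter (B p) j Fin.≟ lookup v p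

module _ {γ P} (B : Box γ P) where

  ∈ᴮ-shrink⁻ : ∀ p C → (∀ {x} → Allowed C x → Allowed (B p) x) →
    ∀ v → v ∈ᴮ VecF.updateAt B p (const C) → Allowed C (lookup v p) × v ∈ᴮ B
  ∈ᴮ-shrink⁻ p C C⊂ v v∈ = at-p , elsewhere
    where
    at-p : Allowed C (lookup v p)
    at-p = subst (λ D → Allowed D (lookup v p)) (updateAt-updates p B) (v∈ p)
    elsewhere : v ∈ᴮ B
    elsewhere q with q Fin.≟ p
    ... | yes refl = C⊂ at-p
    ... | no q≢p   = subst (λ D → Allowed D (lookup v q))
                       (updateAt-minimal q p B q≢p) (v∈ q)

  ∈ᴮ-[]≔ : ∀ v {p d} → v ∈ᴮ B → Allowed (B p) d → (v [ p ]≔ d) ∈ᴮ B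
  ∈ᴮ-[]≔ v {p} {d} v∈B ok q with q Fin.≟ p
  ... | yes refl = subst (Allowed (B p)) (sym (lookup∘update p v d)) ok
  ... | no q≢p   =
    subst (Allowed (B q)) (sym (lookup∘update′ q≢p v d)) (v∈B q)

  first : Vec (Fin γ) P
  first = Vec.tabulate λ p → letter (B p) zero

  first-∈ᴮ : first ∈ᴮ B
  first-∈ᴮ p = zero , sym (lookup∘tabulate _ p)

-- A query whose answer is not the same on the whole box is answered "no" after
-- deleting one letter at one position.
module _ {σ γ P} (S : Vec (Fin γ) P → String σ)
  (S-injective : ∀ v w → S v ≡ S w → ∀ p → lookup v p ≡ lookup w p)
  (single-site : ∀ s v w → s SubstringOf S v → ¬ s SubstringOf S w →
    ∃[ p ] lookup v p ≢ lookup w p ×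
      (∀ u → s SubstringOf S u → lookup u p ≡ lookup v p))
  where

  private
    Correct : Algorithm σ → Box γ P → Set
    Correct A B = ∀ v → v ∈ᴮ B → result A (S v) ≡ S v

  -- Two letters allowed at `p` give two texts of the box that differ only there, yet both must
  -- equal the one output `T`.
  output-determined : ∀ {T B} → Correct (output T) B → ∀ p → extra (B p) ≤ 0
  output-determined {T} {B} correct p = one-choice (B p) λ {d} {e} d-ok e-ok →
    begin
      d                            ≡⟨ lookup∘update p (first B) d ⟨
      lookup (first B [ p ]≔ d) p  ≡⟨ S-injective (first B [ p ]≔ d) (first B [ p ]≔ e)
                                        (trans (sym (correct _ (in-box d-ok)))
                                               (correct _ (in-box e-ok))) p ⟩
      lookup (first B [ p ]≔ e) p  ≡⟨ lookup∘update p (first B) e ⟩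
      e                            ∎
    where
    open ≡-Reasoning
    in-box : ∀ {d} → Allowed (B p) d → (first B [ p ]≔ d) ∈ᴮ B
    in-box = ∈ᴮ-[]≔ B (first B) (first-∈ᴮ B)

  -- The sum of `extra` is a potential: a settled query leaves it alone, any other query lowers it
  -- by at most one, and at a leaf it is zero. The vector returned lies in the last box, so its text
  -- receives exactly the answers given.
  adversary : ∀ A B → Correct A B →
    ∃[ v ] v ∈ᴮ B × ∑ (extra ∘ B) ≤ queries A (S v)
  adversary (output T) B correct = first B , first-∈ᴮ B ,
    ≤-trans (∑-mono (output-determined {T} {B} correct))
            (≤-reflexive (trans (∑-const P 0) (*-zeroʳ P)))
  adversary (ask s k) B correct
    with anyVec? (λ v → (v ∈ᴮ? B) ×-dec (s substringOf? S v))
       | anyVec? (λ v → (v ∈ᴮ? B) ×-dec ¬? (s substringOf? S v))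
  ... | no never | _ =
    let absent = λ v v∈B s⊂ → never (v , v∈B , s⊂)
        v , v∈B , ≤q = adversary (k false) B λ v v∈B →
          trans (sym (proj₁ (ask-no k (absent v v∈B)))) (correct v v∈B)
    in v , v∈B , ≤-trans (m≤n⇒m≤1+n ≤q)
         (≤-reflexive (sym (proj₂ (ask-no k (absent v v∈B)))))
  ... | yes _ | no always =
    let present = λ v v∈B → decidable-stable (s substringOf? S v)
          λ s⊄ → always (v , v∈B , s⊄)
        v , v∈B , ≤q = adversary (k true) B λ v v∈B →
          trans (sym (proj₁ (ask-yes k (present v v∈B)))) (correct v v∈B)
    in v , v∈B , ≤-trans (m≤n⇒m≤1+n ≤q)
         (≤-reflexive (sym (proj₂ (ask-yes k (present v v∈B)))))
  ... | yes (v₁ , v₁∈B , s⊂) | yes (v₀ , v₀∈B , s⊄)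
    -- The letter of `v₁` at `p` is excluded and that of `v₀` survives, so the box stays nonempty.
    -- By `forced`, a text containing `s` has the excluded letter at `p`, so "no" is true on the
    -- whole smaller box.
    with p , differ , forced ← single-site s v₁ v₀ s⊂ s⊄
    with C , extra≡ , C⊂ ← remove (B p) (v₀∈B p) (v₁∈B p) (≢-sym differ) =
    let B′     = VecF.updateAt B p (const C)
        shrink = ∈ᴮ-shrink⁻ B p C (proj₁ ∘ C⊂)
        absent = λ v v∈B′ s⊂v → proj₂ (C⊂ (proj₁ (shrink v v∈B′))) (forced v s⊂v)
        v , v∈B′ , ≤q = adversary (k false) B′ λ v v∈B′ →
          trans (sym (proj₁ (ask-no k (absent v v∈B′))))
                (correct v (proj₂ (shrink v v∈B′)))
    in v , proj₂ (shrink v v∈B′) , (begin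
         ∑ (extra ∘ B)
           ≤⟨ ∑-decrement p
                (≤-reflexive (trans extra≡
                  (cong (suc ∘ extra) (sym (updateAt-updates p B)))))
                (λ q q≢p → ≤-reflexive
                  (cong extra (sym (updateAt-minimal q p B q≢p)))) ⟩
         suc (∑ (extra ∘ B′))
           ≤⟨ s≤s ≤q ⟩
         suc (queries (k false) (S v))
           ≡⟨ proj₂ (ask-no k (absent v v∈B′)) ⟨
         queries (ask s k) (S v)
           ∎)
    where open ≤-Reasoning

-- Counting, and the dictionary of all words of a given length

spell : ∀ L → Fin (σ ^ L) → List (Fin σ)
spell L x = tabulate (finToFun {n = L} x)

length-spell : ∀ L (x : Fin (σ ^ L)) → length (spell {σ} L x) ≡ L
length-spell L x = length-tabulate (finToFun {n = L} x)

tabulate-injective : ∀ {n} {f g : Fin n → A} → tabulate f ≡ tabulate g → ∀ i → f i ≡ g i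
tabulate-injective eq zero    = proj₁ (∷-injective eq)
tabulate-injective eq (suc i) = tabulate-injective (proj₂ (∷-injective eq)) i

funToFin-cong : ∀ {m n} {f g : Fin m → Fin n} → (∀ i → f i ≡ g i) → funToFin f ≡ funToFin g
funToFin-cong {zero}  eq = refl
funToFin-cong {suc m} eq = cong₂ combine (eq zero) (funToFin-cong (eq ∘ suc))

spell-injective : ∀ L {x y : Fin (σ ^ L)} → spell {σ} L x ≡ spell L y → x ≡ y
spell-injective L {x} {y} eq = trans (sym (Fin.funToFin-finToFin {L} x))
  (trans (funToFin-cong {L} (tabulate-injective eq)) (Fin.funToFin-finToFin {L} y))

words : ∀ σ → ℕ → List (List (Fin σ))
words σ L = tabulate (spell L)

length-words : ∀ σ L → length (words σ L) ≡ σ ^ L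
length-words σ L = length-tabulate (spell {σ} L)

∈-words : ∀ (w : List (Fin σ)) → w ∈ words σ (length w)
∈-words {σ} w = subst (_∈ words σ (length w))
  (trans (tabulate-cong (Fin.finToFun-funToFin (List.lookup w))) (tabulate-lookup w))
  (∈-tabulate⁺ (funToFin (List.lookup w)))

words-length : ∀ L {w} → w ∈ words σ L → length w ≡ L
words-length {σ} L w∈ with x , refl ← ∈-tabulate⁻ w∈ = length-spell {σ} L x

words-unique : ∀ σ L → Unique (words σ L)
words-unique σ L = Unique.tabulate⁺ (spell-injective L)

length-concatMap : ∀ (f : A → List B) k xs → (∀ {x} → x ∈ xs → length (f x) ≡ k) →
  length (concatMap f xs) ≡ length xs * k
length-concatMap f k []       eq = refl
length-concatMap f k (x ∷ xs) eq = trans (length-++ (f x))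
  (cong₂ _+_ (eq (here refl)) (length-concatMap f k xs (eq ∘ there)))

infix-concatMap : ∀ (f : A → List B) {x xs} → x ∈ xs → Infix _≡_ (f x) (concatMap f xs)
infix-concatMap f {xs = _ ∷ xs} (here refl) = infix-reflexive refl ⁱ++ concatMap f xs
infix-concatMap f (there x∈) = f _ ++ⁱ infix-concatMap f x∈

-- Since `k ≤ f k`, the test `f k ≤ n` must fail once `k` exceeds `n`; the search carries the
-- invariant `n < d + k` with `d` as fuel.
largest : ∀ (f : ℕ → ℕ) → (∀ k → k ≤ f k) → ∀ n → f 0 ≤ n → ∃[ k ] f k ≤ n × n < f (suc k)
largest f f≥ n = search (suc n) 0 (m≤n⇒m≤n+o 0 (n<1+n n))
  where
  search : ∀ d k → n < d + k → f k ≤ n → ∃[ k ] f k ≤ n × n < f (suc k)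
  search zero    k n<k fk≤n = ⊥-elim (<⇒≱ n<k (≤-trans (f≥ k) fk≤n))
  search (suc d) k n< fk≤n with f (suc k) ≤? n
  ... | yes f≤n = search d (suc k) (≤-trans n< (≤-reflexive (sym (+-suc d k)))) f≤n
  ... | no f≰n  = k , fk≤n , ≰⇒> f≰n

n<b^n : ∀ {b} → 2 ≤ b → ∀ n → n < b ^ n
n<b^n 2≤b zero = s≤s z≤n
n<b^n {b} 2≤b (suc n) = begin-strict
  suc n         ≤⟨ n<b^n 2≤b n ⟩
  b ^ n         <⟨ m<m+n (b ^ n) (≤-trans (s≤s z≤n) (n<b^n 2≤b n)) ⟩
  b ^ n + b ^ n ≡⟨ cong (b ^ n +_) (sym (+-identityʳ (b ^ n))) ⟩
  2 * b ^ n     ≤⟨ *-monoˡ-≤ (b ^ n) 2≤b ⟩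
  b * b ^ n     ∎
  where open ≤-Reasoning

-- From `log_σ n ≤ e` follows `k · log_σ n ≤ e * k`. It is applied with `e` a constant multiple of
-- `L`.
log-≼ : ∀ {σ n} .{{_ : NonZero σ}} e {k t} → n ≤ σ ^ e → e * k ≤ t → k *log⟨ σ ⟩ n ≼ t
log-≼ {σ} {n} e {k} {t} n≤ ek≤t = begin
  n ^ k       ≤⟨ ^-monoˡ-≤ k n≤ ⟩
  (σ ^ e) ^ k ≡⟨ ^-*-assoc σ e k ⟩
  σ ^ (e * k) ≤⟨ ^-monoʳ-≤ σ ek≤t ⟩
  σ ^ t       ∎
  where open ≤-Reasoning

length-filter-split : ∀ {p} {Q : Pred A p} (Q? : Decidable Q) xs →
  length xs ≡ length (filter Q? xs) + length (filter (¬? ∘ Q?) xs)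
length-filter-split Q? []       = refl
length-filter-split Q? (x ∷ xs) with Q? x
... | yes _ = cong suc (length-filter-split Q? xs)
... | no _  = trans (cong suc (length-filter-split Q? xs)) (sym (+-suc _ _))

larger-half : ∀ {p} {Q : Pred A p} (Q? : Decidable Q) xs →
  length xs ≤ 2 * length (filter Q? xs) ⊎ length xs ≤ 2 * length (filter (¬? ∘ Q?) xs)
larger-half Q? xs with length (filter Q? xs) | length (filter (¬? ∘ Q?) xs)
                     | length-filter-split Q? xs
... | a | b | split with ≤-total a b
...   | inj₁ a≤b = inj₂ (≤-trans (≤-reflexive split)
          (≤-trans (+-monoˡ-≤ b a≤b) (≤-reflexive (cong (b +_) (sym (+-identityʳ b))))))
...   | inj₂ b≤a = inj₁ (≤-trans (≤-reflexive split)
          (≤-trans (+-monoʳ-≤ a b≤a) (≤-reflexive (cong (a +_) (sym (+-identityʳ a))))))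

-- Following the larger half keeps the candidates nonempty and distinct, and a correct leaf can
-- serve only one of them.
counting : ∀ (A : Algorithm σ) xs → 1 ≤ length xs → Unique xs →
  (∀ {S} → S ∈ xs → result A S ≡ S) →
  ∃[ S ] S ∈ xs × length xs ≤ 2 ^ queries A S
counting (output T) (S ∷ [])     _ _ correct = S , here refl , ≤-refl
counting (output T) (S ∷ S′ ∷ _) _ ((S≢S′ ∷ _) ∷ _) correct =
  ⊥-elim (S≢S′ (trans (sym (correct (here refl))) (correct (there (here refl)))))
counting {σ} (ask s k) xs nonempty unique correct
  with larger-half (s substringOf?_) xs
... | inj₁ half =
  let S , S∈ , ≤q = counting (k true) _ (positive (filter (s substringOf?_) xs) half)
        (Unique.filter⁺ (s substringOf?_) unique)
        λ {S} S∈ → let S∈xs , s⊂ = ∈-filter⁻ (s substringOf?_) {xs = xs} S∈ in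
          trans (sym (proj₁ (ask-yes k s⊂))) (correct S∈xs)
      S∈xs , s⊂ = ∈-filter⁻ (s substringOf?_) {xs = xs} S∈
  in S , S∈xs , ≤-trans half (≤-trans (*-monoʳ-≤ 2 ≤q)
       (≤-reflexive (cong (2 ^_) (sym (proj₂ (ask-yes k s⊂))))))
  where
  positive : ∀ (ys : List (String σ)) → length xs ≤ 2 * length ys → 1 ≤ length ys
  positive []      l = ⊥-elim (<⇒≱ nonempty l)
  positive (_ ∷ _) l = s≤s z≤n
... | inj₂ half =
  let S , S∈ , ≤q = counting (k false) _ (positive (filter (¬? ∘ (s substringOf?_)) xs) half)
        (Unique.filter⁺ (¬? ∘ (s substringOf?_)) unique)
        λ {S} S∈ → let S∈xs , s⊄ = ∈-filter⁻ (¬? ∘ (s substringOf?_)) {xs = xs} S∈ in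
          trans (sym (proj₁ (ask-no k s⊄))) (correct S∈xs)
      S∈xs , s⊄ = ∈-filter⁻ (¬? ∘ (s substringOf?_)) {xs = xs} S∈
  in S , S∈xs , ≤-trans half (≤-trans (*-monoʳ-≤ 2 ≤q)
       (≤-reflexive (cong (2 ^_) (sym (proj₂ (ask-no k s⊄))))))
  where
  positive : ∀ (ys : List (String σ)) → length xs ≤ 2 * length ys → 1 ≤ length ys
  positive []      l = ⊥-elim (<⇒≱ nonempty l)
  positive (_ ∷ _) l = s≤s z≤n

-- Bounded alphabets

module SmallAlphabet {σ n : ℕ} (2≤σ : 2 ≤ σ) (2σ≤n : 2 * σ ≤ n) where

  private instance
    σ≢0 : NonZero σ
    σ≢0 = >-nonZero (≤-trans (s≤s z≤n) 2≤σ)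

  dictionary-size : ℕ → ℕ
  dictionary-size l = σ ^ suc l * suc l

  -- L = l + 1 is to be the largest number with 2 L² σ^L ≤ n.
  growth : ℕ → ℕ
  growth l = 2 * (suc l * dictionary-size l)

  suc≤dictionary-size : ∀ l → suc l ≤ dictionary-size l
  suc≤dictionary-size l = m≤n*m (suc l) (σ ^ suc l) {{m^n≢0 σ (suc l)}}

  growth≥ : ∀ l → l ≤ growth l
  growth≥ l = begin
    l                               ≤⟨ n≤1+n l ⟩
    suc l                           ≤⟨ suc≤dictionary-size l ⟩
    dictionary-size l               ≤⟨ m≤n*m (dictionary-size l) (suc l) ⟩
    suc l * dictionary-size l       ≤⟨ m≤n*m (suc l * dictionary-size l) 2 ⟩
    2 * (suc l * dictionary-size l) ∎
    where open ≤-Reasoning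

  module _ (l : ℕ) (growth≤n : growth l ≤ n) (n<growth : n < growth (suc l)) where

    L : ℕ
    L = suc l

    D : String σ
    D = concat (words σ L)

    length-D : length D ≡ dictionary-size l
    length-D = trans (cong length (sym (cong concat (map-id (words σ L)))))
      (trans (length-concatMap (λ w → w) L (words σ L) (words-length L))
        (cong (_* L) (length-words σ L)))

    N : ℕ
    N = n ∸ length D

    -- This is what the second factor `L` in `growth` buys: the dictionary is parsed letter by
    -- letter, and its `length D` literals must not exceed the order of `N / L`. The factor `2`
    -- leaves room for the hidden part after the dictionary.
    L*D≤N : L * length D ≤ N
    L*D≤N = begin
      L * length D ≡⟨ cong (L *_) length-D ⟩
      X            ≡⟨ m+n∸n≡m X X ⟨
      X + X ∸ X    ≤⟨ ∸-mono X+X≤n D≤X ⟩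
      N            ∎
      where
      open ≤-Reasoning
      X = L * dictionary-size l
      X+X≤n : X + X ≤ n
      X+X≤n = ≤-trans (≤-reflexive (cong (X +_) (sym (+-identityʳ X)))) growth≤n
      D≤X : length D ≤ X
      D≤X = ≤-trans (≤-reflexive length-D) (m≤n*m (dictionary-size l) L)

    L≤N : L ≤ N
    L≤N = ≤-trans (≤-trans (suc≤dictionary-size l) (≤-reflexive (sym length-D)))
      (≤-trans (m≤n*m (length D) L) L*D≤N)

    length-text : ∀ u → length u ≡ N → length (D ++ u) ≡ n
    length-text u eq = trans (length-++ D) (trans (cong (length D +_) eq)
      (m+[n∸m]≡n (≤-trans (m≤n*m (length D) L) (≤-trans L*D≤N (m∸n≤m n (length D))))))

    k : ℕ
    k = suc (N / L)

    N≤kL : N ≤ k * L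
    N≤kL = begin
      N               ≡⟨ m≡m%n+[m/n]*n N L ⟩
      N % L + N / L * L ≤⟨ +-monoˡ-≤ (N / L * L) (<⇒≤ (m%n<n N L)) ⟩
      k * L           ∎
      where open ≤-Reasoning

    -- A short word is completed to length `L` and found as a prefix of a dictionary word. Shorter
    -- words matter because the last chunk of the hidden part can be incomplete.
    short-words-occur : ∀ w → All (λ _ → ⊤) w → length w ≤ L → w SubstringOf D
    short-words-occur w _ len = infix-trans (infix-reflexive refl ⁱ++ filler)
      (subst (λ vs → Infix _≡_ (w ++ filler) (concat vs)) (map-id (words σ L))
        (infix-concatMap (λ w → w)
          (subst (λ m → (w ++ filler) ∈ words σ m) filled (∈-words (w ++ filler)))))
      where
      filler : String σ
      filler = replicate (L ∸ length w) (fromℕ< (≤-trans (s≤s z≤n) 2≤σ))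
      filled : length (w ++ filler) ≡ L
      filled = trans (length-++ w) (trans (cong (length w +_) (length-replicate (L ∸ length w)))
        (m+[n∸m]≡n len))

    -- The three shares of `N` pay for the dictionary, the one chunk added by rounding up, and the
    -- full chunks.
    few-phrases : ∀ u → length u ≡ N → L * z-no (D ++ u) ≤ 3 * N
    few-phrases u eq = begin
      L * z-no (D ++ u)      ≤⟨ *-monoʳ-≤ L (z-no≤ (Parse-++ (Parse-literals D)
                                 (Parse-chunks short-words-occur k u (All.universal _ u)
                                   (≤-trans (≤-reflexive eq) N≤kL)))) ⟩
      L * (length D + k)     ≡⟨ *-distribˡ-+ L (length D) k ⟩
      L * length D + L * k   ≡⟨ cong (λ t → L * length D + t) (*-comm L k) ⟩
      L * length D + (L + N / L * L) ≤⟨ +-mono-≤ L*D≤N (+-mono-≤ L≤N (m/n*n≤m N L)) ⟩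
      N + (N + N)            ≡⟨ cong (λ t → N + (N + t)) (sym (+-identityʳ N)) ⟩
      3 * N                  ∎
      where open ≤-Reasoning

    -- Maximality of `L` gives `n < 2 * (L + 1)² * σ ^ (L + 1)`. Here `2 ≤ σ` and `L + 1 ≤ σ ^ L`,
    -- so the exponent is at most `2 + 3 * L`, and `L ≥ 1`.
    n≤σ^ : n ≤ σ ^ (5 * L)
    n≤σ^ = begin
      n
        ≤⟨ <⇒≤ n<growth ⟩
      2 * (suc L * (σ ^ suc L * suc L))
        ≤⟨ *-mono-≤ 2≤σ (*-mono-≤ (n<b^n 2≤σ L) (*-monoʳ-≤ (σ ^ suc L) (n<b^n 2≤σ L))) ⟩
      σ * (σ ^ L * (σ * σ ^ L * σ ^ L))
        ≡⟨ rearrange σ (σ ^ L) ⟩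
      σ ^ 2 * (σ ^ L) ^ 3
        ≡⟨ cong (σ ^ 2 *_) (^-*-assoc σ L 3) ⟩
      σ ^ 2 * σ ^ (L * 3)
        ≡⟨ ^-distribˡ-+-* σ 2 (L * 3) ⟨
      σ ^ (2 + L * 3)
        ≤⟨ ^-monoʳ-≤ σ (+-monoˡ-≤ (L * 3) {2} {L * 2} (m≤n*m 2 L)) ⟩
      σ ^ (L * 2 + L * 3)
        ≡⟨ cong (σ ^_) (trans (sym (*-distribˡ-+ L 2 3)) (*-comm L 5)) ⟩
      σ ^ (5 * L)
        ∎
      where
      open ≤-Reasoning
      rearrange : ∀ s t → s * (t * (s * t * t)) ≡ s * (s * 1) * (t * (t * (t * 1)))
      rearrange = solve-∀

    -- The constant is `240 = 5 * 16 * 3`, from `log_σ n ≤ 5 * L`, `σ ≤ 16` and `L * z ≤ 3 * N`;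
    -- counting the `σ ^ N` texts yields at least `N` queries.
    lower-bound-at : σ ≤ 16 → (A : Algorithm σ) → Reconstructs A n →
      ∃[ S ] (length S ≡ n × (σ * z-no S) *log⟨ σ ⟩ n ≼ (240 * queries A S))
    lower-bound-at σ≤16 A correct
      with counting A texts many unique (λ S∈ → correct _ (text-length S∈))
      where
      texts : List (String σ)
      texts = map (D ++_) (words σ N)
      length-texts : length texts ≡ σ ^ N
      length-texts = trans (length-map (D ++_) (words σ N)) (length-words σ N)
      many : 1 ≤ length texts
      many = ≤-trans (m^n>0 σ N) (≤-reflexive (sym length-texts))
      unique : Unique texts
      unique = Unique.map⁺ (++-cancelˡ D _ _) (words-unique σ N)
      text-length : ∀ {S} → S ∈ texts → length S ≡ n
      text-length S∈ with u , u∈ , refl ← ∈-map⁻ (D ++_) S∈ =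
        length-text u (words-length N u∈)
    ... | S , S∈ , ≤q with u , u∈ , refl ← ∈-map⁻ (D ++_) S∈ =
      D ++ u , length-text u (words-length N u∈) , log-≼ (5 * L) n≤σ^ (begin
        5 * L * (σ * z)      ≤⟨ *-monoʳ-≤ (5 * L) (*-monoˡ-≤ z σ≤16) ⟩
        5 * L * (16 * z)     ≡⟨ regroup L z ⟩
        80 * (L * z)         ≤⟨ *-monoʳ-≤ 80 (few-phrases u (words-length N u∈)) ⟩
        80 * (3 * N)         ≡⟨ *-assoc 80 3 N ⟨
        240 * N              ≤⟨ *-monoʳ-≤ 240 N≤q ⟩
        240 * queries A (D ++ u) ∎)
      where
      open ≤-Reasoning
      z = z-no (D ++ u)
      regroup : ∀ L z → 5 * L * (16 * z) ≡ 80 * (L * z)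
      regroup = solve-∀
      N≤q : N ≤ queries A (D ++ u)
      N≤q = ≮⇒≥ λ q<N → <⇒≱ (^-monoʳ-< 2 ≤-refl q<N) (begin
        2 ^ N                      ≤⟨ ^-monoˡ-≤ N 2≤σ ⟩
        σ ^ N                      ≡⟨ trans (length-map (D ++_) (words σ N)) (length-words σ N) ⟨
        length (map (D ++_) (words σ N)) ≤⟨ ≤q ⟩
        2 ^ queries A (D ++ u)     ∎)

  lower-bound : σ ≤ 16 → (A : Algorithm σ) → Reconstructs A n →
    ∃[ S ] (length S ≡ n × (σ * z-no S) *log⟨ σ ⟩ n ≼ (240 * queries A S))
  lower-bound = let l , g≤n , n<g = largest growth growth≥ n first-fits in lower-bound-at l g≤n n<g
    where
    -- `growth 0` is `2 * σ`, so the assumption `2σ≤n` says that `L = 1` fits.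
    first-fits : growth 0 ≤ n
    first-fits = ≤-trans (≤-reflexive (simplify σ)) 2σ≤n
      where
      simplify : ∀ σ → 2 * (1 * (σ * 1 * 1)) ≡ 2 * σ
      simplify = solve-∀

-- Texts with hidden letters

split-at : ∀ (X : List A) {x Y} U {V} → X ++ x ∷ Y ≡ U ++ V →
  (∃[ U₂ ] U ≡ X ++ x ∷ U₂ × Y ≡ U₂ ++ V) ⊎
  (∃[ X₂ ] X ≡ U ++ X₂ × X₂ ++ x ∷ Y ≡ V)
split-at X       []      eq = inj₂ (X , refl , eq)
split-at []      (u ∷ U) eq with refl , eq′ ← ∷-injective eq = inj₁ (U , refl , eq′)
split-at (x ∷ X) (u ∷ U) eq with refl , eq′ ← ∷-injective eq with split-at X U eq′
... | inj₁ (U₂ , refl , q) = inj₁ (U₂ , refl , q)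
... | inj₂ (X₂ , refl , q) = inj₂ (X₂ , refl , q)

map-split : ∀ (f : A → B) w X {y Y} → map f w ≡ X ++ y ∷ Y →
  ∃[ u ] ∃[ x ] ∃[ v ] w ≡ u ++ x ∷ v × X ≡ map f u × y ≡ f x × Y ≡ map f v
map-split f w X eq with u , x ∷ v , refl , refl , refl ← map-++⁻ f w X eq =
  u , x , v , refl , refl , refl , refl

-- The content of a cell is a parameter, so that the same blocks can be written over positions, over
-- letters, or over a mixture of both.
data Letter (C H : Set) : Set where
  pad  : Letter C H
  mark : C → Letter C H
  cell : H → Letter C H

mapᴸ : (H → K) → Letter C H → Letter C K
mapᴸ f pad      = pad
mapᴸ f (mark c) = mark c
mapᴸ f (cell h) = cell (f h)

data NotMark {C H : Set} : Letter C H → Set where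
  pad  : NotMark pad
  cell : ∀ {h} → NotMark (cell h)

data NotCell {C H : Set} : Letter C H → Set where
  pad  : NotCell pad
  mark : ∀ {c} → NotCell (mark c)

run : ℕ → List (Letter C H)
run k = replicate k pad

run-+ : ∀ j k → run j ++ run k ≡ run {C} {H} (j + k)
run-+ zero    k = refl
run-+ (suc j) k = cong (pad ∷_) (run-+ j k)

record Block (C H : Set) : Set where
  constructor ⟨_,_,_⟩
  field
    lead : C
    gap  : ℕ
    word : List H

open Block public

mapᴮ : (H → K) → Block C H → Block C K
mapᴮ f ⟨ c , i , w ⟩ = ⟨ c , i , map f w ⟩

-- Reading a text backwards mirrors its blocks and keeps their names; windows that reach the closing
-- mark are thereby reduced to those that start at an opening one.
mirror : Block C H → Block C H
mirror ⟨ c , i , w ⟩ = ⟨ c , i , reverse w ⟩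

body : Block C H → List (Letter C H)
body ⟨ c , i , w ⟩ = run i ++ map cell w ++ run i

render : Block C H → List (Letter C H)
render b = mark (lead b) ∷ body b ++ [ mark (lead b) ]

renders : List (Block C H) → List (Letter C H)
renders = concatMap render

run-NotMark : ∀ i → All NotMark (run {C} {H} i)
run-NotMark i = All.replicate⁺ i pad

body-NotMark : ∀ (b : Block C H) → All NotMark (body b)
body-NotMark ⟨ c , i , w ⟩ = All.++⁺ (run-NotMark i)
  (All.++⁺ (All.map⁺ (All.universal (λ _ → cell) w)) (run-NotMark i))

absent : ∀ {Q : A → Set} X {x Y U} → All Q U → ¬ Q x → U ≢ X ++ x ∷ Y
absent X qs ¬q refl = ¬q (All.head (All.++⁻ʳ X qs))

-- The first letter other than `pad` ends the run on both sides. This is how a gap is read off a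
-- substring.
scan : ∀ i k {d : H} {U} {x : Letter C H} {R} → x ≢ pad →
  run i ++ cell d ∷ U ≡ run k ++ x ∷ R → i ≡ k × cell d ∷ U ≡ x ∷ R
scan zero    zero    x≢pad eq = refl , eq
scan zero    (suc k) x≢pad ()
scan (suc i) zero    x≢pad eq = ⊥-elim (x≢pad (sym (proj₁ (∷-injective eq))))
scan (suc i) (suc k) x≢pad eq with refl , eq′ ← scan i k x≢pad (proj₂ (∷-injective eq)) =
  refl , eq′

run-++-mark : ∀ k {c : C} {R} h {Y : List (Letter C H)} →
  map cell h ++ Y ≡ run k ++ mark c ∷ R → h ≡ []
run-++-mark k       []      eq = refl
run-++-mark zero    (x ∷ h) ()
run-++-mark (suc k) (x ∷ h) ()

cells-prefix : ∀ (h w : List H) {Y : List (Letter C H)} {k c R} →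
  map cell h ++ Y ≡ map cell w ++ run k ++ mark c ∷ R → ∃[ v ] w ≡ h ++ v
cells-prefix []      w       eq = w , refl
cells-prefix (d ∷ h) []      {k = k} eq with () ← run-++-mark k (d ∷ h) eq
cells-prefix (d ∷ h) (e ∷ w) eq with refl , eq′ ← ∷-injective eq
  with v , refl ← cells-prefix h w eq′ = v , refl

-- A window starting just after the opening mark shows the gap by `scan`; its cells cannot outrun
-- the word, since a pad or a mark comes next.
body-prefix : ∀ (b : Block C H) i d h {Y c R} →
  run i ++ map cell (d ∷ h) ++ Y ≡ body b ++ mark c ∷ R →
  i ≡ gap b × ∃[ v ] word b ≡ (d ∷ h) ++ v
body-prefix ⟨ _ , k , [] ⟩ i d h {c = c} {R} eq
  with () ← proj₂ (scan i (k + k) {x = mark c} (λ ()) (trans eq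
    (cong (_++ mark c ∷ R) (run-+ k k))))
body-prefix ⟨ _ , k , e ∷ w ⟩ i d h {Y} {c} {R} eq
  with scan i k (λ ()) (trans eq (trans
         (++-assoc (run k) (cell e ∷ map cell w ++ run k) (mark c ∷ R))
         (cong (λ t → run k ++ cell e ∷ t) (++-assoc (map cell w) (run k) (mark c ∷ R)))))
... | i≡k , eq′ with refl , eq″ ← ∷-injective eq′
  with v , refl ← cells-prefix h w eq″ = i≡k , v , refl

render-++ : ∀ (b : Block C H) R → render b ++ R ≡ mark (lead b) ∷ body b ++ mark (lead b) ∷ R
render-++ b R = cong (mark (lead b) ∷_) (++-assoc (body b) [ mark (lead b) ] R)

renders-∷-++ : ∀ (b : Block C H) bs E →
  renders (b ∷ bs) ++ E ≡ mark (lead b) ∷ body b ++ mark (lead b) ∷ renders bs ++ E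
renders-∷-++ b bs E = trans (++-assoc (render b) (renders bs) E) (render-++ b (renders bs ++ E))

-- A mark followed by `i` pads and a cell is an opening mark: after a closing mark comes either the
-- next opening mark or `E`, and `¬start` forbids `E` to continue the window. Read forwards, `E` is
-- empty; read backwards, it is the reversed dictionary.
anchored-∷ : ∀ (bs : List (Block C H)) {E} → All NotMark E →
  ∀ {c i d h Y} → (∀ d U → run i ++ cell d ∷ U ≢ E) →
  ∀ X → X ++ mark c ∷ run i ++ map cell (d ∷ h) ++ Y ≡ renders bs ++ E →
  ∃[ w ] ⟨ c , i , w ⟩ ∈ bs × ∃[ v ] w ≡ (d ∷ h) ++ v
anchored-∷ [] free ¬start X eq = ⊥-elim (absent X free (λ ()) (sym eq))
anchored-∷ (b ∷ bs) {E} free {i = i} {d} {h} {Y} ¬start X eq with trans eq (renders-∷-++ b bs E)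
anchored-∷ (b ∷ bs) free ¬start [] eq | eq′ with refl , eq″ ← ∷-injective eq′
  with refl , v , w≡ ← body-prefix b _ _ _ eq″ = word b , here refl , v , w≡
anchored-∷ (b ∷ bs) {E} free {i = i} {d} {h} {Y} ¬start (_ ∷ X) eq | eq′
  with split-at X (body b) (proj₂ (∷-injective eq′))
... | inj₁ (_ , body≡ , _) = ⊥-elim (absent X (body-NotMark b) (λ ()) body≡)
... | inj₂ ([] , _ , eq″) with refl , eq‴ ← ∷-injective eq″ = ⊥-elim (closing bs eq‴)
  where
  closing : ∀ bs → run i ++ map cell (d ∷ h) ++ Y ≢ renders bs ++ E
  closing []       = ¬start d _
  closing (b ∷ bs) q
    with () ← proj₂ (scan i 0 (λ ()) (trans q (renders-∷-++ b bs E)))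
... | inj₂ (_ ∷ X₂ , _ , eq″)
  with w , w∈ , rest ← anchored-∷ bs free ¬start X₂ (proj₂ (∷-injective eq″)) =
  w , there w∈ , rest

anchored : ∀ (bs : List (Block C H)) {E} → All NotMark E →
  ∀ {c i Y} → (∀ d U → run i ++ cell d ∷ U ≢ E) →
  ∀ h → h ≢ [] → ∀ X → X ++ mark c ∷ (run i ++ map cell h) ++ Y ≡ renders bs ++ E →
  ∃[ w ] ⟨ c , i , w ⟩ ∈ bs × ∃[ v ] w ≡ h ++ v
anchored bs free ¬start []      h≢[] X eq = ⊥-elim (h≢[] refl)
anchored bs free {c} {i} {Y} ¬start (d ∷ h) _ X eq = anchored-∷ bs free ¬start X
  (trans (cong (λ t → X ++ mark c ∷ t) (sym (++-assoc (run i) (map cell (d ∷ h)) Y))) eq)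

-- Neither marks nor pads are cells, so a cell belongs to the word of some block. The two
-- factorizations keep everything between it and the two marks of that block.
locate : ∀ (bs : List (Block C H)) X {p Y} → X ++ cell p ∷ Y ≡ renders bs →
  ∃[ b ] b ∈ bs × ∃[ u ] ∃[ v ] word b ≡ u ++ p ∷ v ×
  (∃[ Z ] X ≡ Z ++ mark (lead b) ∷ run (gap b) ++ map cell u) ×
  (∃[ Z ] Y ≡ map cell v ++ run (gap b) ++ mark (lead b) ∷ Z)
locate [] [] ()
locate [] (_ ∷ _) ()
locate (b ∷ bs) X eq with trans eq (render-++ b (renders bs))
locate (b ∷ bs) [] eq | ()
locate (b@(⟨ c , i , w ⟩) ∷ bs) (_ ∷ X) eq | eq′ with refl , eq″ ← ∷-injective eq′
  with split-at X (body b) eq″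
... | inj₁ (U , body≡ , refl) with split-at X (run i) (sym body≡)
...   | inj₁ (_ , run≡ , _) = ⊥-elim (absent {Q = NotCell} X (All.replicate⁺ i pad) (λ ()) run≡)
...   | inj₂ (X₂ , refl , q) with split-at X₂ (map cell w) q
...     | inj₂ (X₃ , _ , run≡) =
  ⊥-elim (absent {Q = NotCell} X₃ (All.replicate⁺ i pad) (λ ()) (sym run≡))
...     | inj₁ (U₂ , w≡ , refl)
  with u , _ , v , refl , refl , refl , refl ← map-split cell w X₂ w≡ =
  b , here refl , u , v , refl , ([] , refl) , (renders bs , ++-assoc (map cell v) (run i) _)
locate (b ∷ bs) (_ ∷ X) eq | eq′ | inj₂ ([] , _ , ())
locate (b ∷ bs) (_ ∷ X) eq | eq′ | inj₂ (_ ∷ X₂ , refl , q)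
  with refl , q′ ← ∷-injective q
  with b′ , b′∈ , u , v , w≡ , (Z , refl) , right ← locate bs X₂ q′ =
  b′ , there b′∈ , u , v , w≡ ,
  (mark (lead b) ∷ body b ++ mark (lead b) ∷ Z ,
   cong (mark (lead b) ∷_) (sym (++-assoc (body b) (mark (lead b) ∷ Z) _))) , right

reverse-run : ∀ i → reverse (run {C} {H} i) ≡ run i
reverse-run zero    = refl
reverse-run (suc i) = begin
  reverse (run (suc i)) ≡⟨ unfold-reverse pad (run i) ⟩
  reverse (run i) ∷ʳ pad ≡⟨ cong (_∷ʳ pad) (reverse-run i) ⟩
  run i ++ run 1         ≡⟨ run-+ i 1 ⟩
  run (i + 1)            ≡⟨ cong run (+-comm i 1) ⟩
  run (suc i)            ∎
  where open ≡-Reasoning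

reverse-body : ∀ (b : Block C H) → reverse (body b) ≡ body (mirror b)
reverse-body ⟨ c , i , w ⟩ = begin
  reverse (run i ++ map cell w ++ run i)
    ≡⟨ reverse-++ (run i) (map cell w ++ run i) ⟩
  reverse (map cell w ++ run i) ++ reverse (run i)
    ≡⟨ cong (_++ reverse (run i)) (reverse-++ (map cell w) (run i)) ⟩
  (reverse (run i) ++ reverse (map cell w)) ++ reverse (run i)
    ≡⟨ ++-assoc (reverse (run i)) _ _ ⟩
  reverse (run i) ++ reverse (map cell w) ++ reverse (run i)
    ≡⟨ cong₂ (λ r x → r ++ x ++ r) (reverse-run i) (sym (reverse-map cell w)) ⟩
  run i ++ map cell (reverse w) ++ run i
    ∎
  where open ≡-Reasoning

reverse-render : ∀ (b : Block C H) → reverse (render b) ≡ render (mirror b)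
reverse-render b@(⟨ c , _ , _ ⟩) = begin
  reverse (mark c ∷ body b ++ [ mark c ])
    ≡⟨ unfold-reverse (mark c) (body b ++ [ mark c ]) ⟩
  reverse (body b ++ [ mark c ]) ∷ʳ mark c
    ≡⟨ cong (_∷ʳ mark c) (reverse-++ (body b) [ mark c ]) ⟩
  mark c ∷ reverse (body b) ++ [ mark c ]
    ≡⟨ cong (λ t → mark c ∷ t ++ [ mark c ]) (reverse-body b) ⟩
  render (mirror b)
    ∎
  where open ≡-Reasoning

reverse-renders : ∀ (bs : List (Block C H)) →
  reverse (renders bs) ≡ renders (reverse (map mirror bs))
reverse-renders []       = refl
reverse-renders (b ∷ bs) = begin
  reverse (render b ++ renders bs)
    ≡⟨ reverse-++ (render b) (renders bs) ⟩
  reverse (renders bs) ++ reverse (render b)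
    ≡⟨ cong₂ _++_ (reverse-renders bs) (trans (reverse-render b) (sym (++-identityʳ _))) ⟩
  renders (reverse (map mirror bs)) ++ renders [ mirror b ]
    ≡⟨ concatMap-++ render (reverse (map mirror bs)) [ mirror b ] ⟨
  renders (reverse (map mirror bs) ∷ʳ mirror b)
    ≡⟨ cong renders (unfold-reverse (mirror b) (map mirror bs)) ⟨
  renders (reverse (map mirror (b ∷ bs)))
    ∎
  where open ≡-Reasoning

map-cells : ∀ (f : H → K) w → map (mapᴸ {C = C} f) (map cell w) ≡ map cell (map f w)
map-cells f w = trans (sym (map-∘ w)) (map-∘ w)

map-body : ∀ (f : H → K) (b : Block C H) → map (mapᴸ f) (body b) ≡ body (mapᴮ f b)
map-body f ⟨ c , i , w ⟩ = begin
  map (mapᴸ f) (run i ++ map cell w ++ run i)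
    ≡⟨ map-++ (mapᴸ f) (run i) (map cell w ++ run i) ⟩
  map (mapᴸ f) (run i) ++ map (mapᴸ f) (map cell w ++ run i)
    ≡⟨ cong (map (mapᴸ f) (run i) ++_) (map-++ (mapᴸ f) (map cell w) (run i)) ⟩
  map (mapᴸ f) (run i) ++ map (mapᴸ f) (map cell w) ++ map (mapᴸ f) (run i)
    ≡⟨ cong₂ (λ r x → r ++ x ++ r) (map-replicate (mapᴸ f) i pad) (map-cells f w) ⟩
  run i ++ map cell (map f w) ++ run i
    ∎
  where open ≡-Reasoning

map-render : ∀ (f : H → K) (b : Block C H) → map (mapᴸ f) (render b) ≡ render (mapᴮ f b)
map-render f b = cong (mark (lead b) ∷_) (trans (map-++ (mapᴸ f) (body b) _)
  (cong (_++ [ mark (lead b) ]) (map-body f b)))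

map-renders : ∀ (f : H → K) (bs : List (Block C H)) →
  map (mapᴸ f) (renders bs) ≡ renders (map (mapᴮ f) bs)
map-renders f bs = trans (map-concatMap (mapᴸ f) render bs)
  (trans (concatMap-cong (map-render f) bs) (sym (concatMap-map render (mapᴮ f) bs)))

mapᴮ-∘ : ∀ (g : K → A) (f : H → K) (bs : List (Block C H)) →
  map (mapᴮ g) (map (mapᴮ f) bs) ≡ map (mapᴮ (g ∘ f)) bs
mapᴮ-∘ g f bs = trans (sym (map-∘ bs))
  (map-cong (λ { ⟨ c , i , w ⟩ → cong (⟨ c , i ,_⟩) (sym (map-∘ w)) }) bs)

same-letter : ∀ (f g : P → K) u {p} u′ {v} →
  map g (u ++ p ∷ u′) ≡ map f (u ++ [ p ]) ++ v → g p ≡ f p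
same-letter f g []      u′ eq = proj₁ (∷-injective eq)
same-letter f g (_ ∷ u) u′ eq = same-letter f g u u′ (proj₂ (∷-injective eq))

run-cell≢[] : ∀ i (d : H) (U : List (Letter C H)) → run i ++ cell d ∷ U ≢ []
run-cell≢[] zero    _ _ ()
run-cell≢[] (suc _) _ _ ()

run-cell≢run : ∀ {i k} → i < k → ∀ (d : H) (U R : List (Letter C H)) →
  run i ++ cell d ∷ U ≢ run k ++ R
run-cell≢run {i = zero}  {suc _} _         d U R ()
run-cell≢run {i = suc _} {suc _} (s≤s i<k) d U R eq =
  run-cell≢run i<k d U R (proj₂ (∷-injective eq))

map-snoc≢[] : ∀ (f : A → B) u {p} → map f (u ++ [ p ]) ≢ []
map-snoc≢[] f []      ()
map-snoc≢[] f (_ ∷ _) ()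

reverse-split : ∀ (u : List A) {p v} → reverse (u ++ p ∷ v) ≡ reverse v ++ p ∷ reverse u
reverse-split u {p} {v} = trans (reverse-++ u (p ∷ v))
  (trans (cong (_++ reverse u) (unfold-reverse p v)) (++-assoc (reverse v) [ p ] (reverse u)))

reverse-infix : ∀ (X s Y : List A) → reverse (X ++ s ++ Y) ≡ reverse Y ++ reverse s ++ reverse X
reverse-infix X s Y = trans (reverse-++ X (s ++ Y))
  (trans (cong (_++ reverse X) (reverse-++ s Y)) (++-assoc (reverse Y) (reverse s) (reverse X)))

clip-left : ∀ X {t} W {c : C} {R : List (Letter C H)} → X ++ t ≡ W ++ mark c ∷ R →
  (∃[ e ] t ≡ e ++ mark c ∷ R) ⊎ (∃[ e ] R ≡ e ++ t)
clip-left X {t} W eq with ++-compare X t W _ eq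
... | inj₁ ([] , _ , refl)    = inj₁ ([] , refl)
... | inj₁ (_ ∷ e , _ , refl) = inj₂ (e , refl)
... | inj₂ (e , _ , refl)     = inj₁ (e , refl)

clip-right : ∀ t {Y} R {c : C} {Z : List (Letter C H)} → t ++ Y ≡ R ++ mark c ∷ Z →
  (∃[ e ] t ≡ R ++ mark c ∷ e) ⊎ (∃[ e ] R ≡ t ++ e)
clip-right t {Y} R eq with ++-compare t Y R _ eq
... | inj₁ ([] , refl , _)       = inj₂ ([] , trans (sym (++-identityʳ R)) (sym (++-identityʳ _)))
... | inj₁ (_ ∷ e , refl , refl) = inj₁ (e , refl)
... | inj₂ (e , refl , _)        = inj₂ (e , refl)

-- Hidden letters f : P → K are written into the blocks behind a fixed dictionary
-- D. A window reaching from a hidden letter to a mark of its block determines the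
-- lead and gap of the block; every other window lies inside a body, hence in D.
module Hidden (_≟_ : DecidableEquality K) (D : List (Letter C K)) (M : ℕ)
  (bs : List (Block C P))
  (D-unmarked : All NotMark D)
  (D-ends     : ∃[ D₀ ] D ≡ D₀ ++ run M)
  (short-gaps : ∀ {b} → b ∈ bs → gap b < M)
  (distinct   : ∀ {b b′} → b ∈ bs → b′ ∈ bs → lead b ≡ lead b′ → gap b ≡ gap b′ → b ≡ b′)
  (covers     : ∀ {b} f → b ∈ bs → Infix _≡_ (body (mapᴮ f b)) D)
  (used       : ∀ p → ∃[ b ] b ∈ bs × p ∈ word b)
  where

  text : (P → K) → List (Letter C K)
  text f = D ++ renders (map (mapᴮ f) bs)

  -- Positions stand where hidden letters will be, so every text is a filling of this one list. A
  -- window found in `text f` can thus be carried to the same place in `text g`.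
  template : List (Letter C (K ⊎ P))
  template = map (mapᴸ inj₁) D ++ renders (map (mapᴮ inj₂) bs)

  fill : (P → K) → Letter C (K ⊎ P) → Letter C K
  fill f = mapᴸ [ id , f ]′

  fill-template : ∀ f → map (fill f) template ≡ text f
  fill-template f = trans (map-++ (fill f) (map (mapᴸ inj₁) D) _) (cong₂ _++_
    (trans (sym (map-∘ D)) (trans
      (map-cong (λ { pad → refl ; (mark _) → refl ; (cell _) → refl }) D) (map-id D)))
    (trans (map-renders [ id , f ]′ (map (mapᴮ inj₂) bs))
      (cong renders (mapᴮ-∘ [ id , f ]′ inj₂ bs))))

  block-word : ∀ (f : P → K) {b b′} → b′ ∈ map (mapᴮ f) bs → b ∈ bs →
    lead b ≡ lead b′ → gap b ≡ gap b′ → map f (word b) ≡ word b′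
  block-word f b′∈ b∈ lead≡ gap≡ with b″ , b″∈ , refl ← ∈-map⁻ (mapᴮ f) b′∈
    with refl ← distinct b∈ b″∈ lead≡ gap≡ = refl

  -- The dictionary has no marks, so `anchored` places the window at an opening mark of a block with
  -- the same lead and gap; by `distinct` that block is `b`, and the letters at `p` are compared
  -- there.
  pinnedˡ : ∀ {b u p v} f g → b ∈ bs → word b ≡ u ++ p ∷ v →
    Infix _≡_ (mark (lead b) ∷ run (gap b) ++ map cell (map f (u ++ [ p ]))) (text g) → g p ≡ f p
  pinnedˡ {b} {u} {p} {v} f g b∈ w≡ s⊂ with infix⁻ s⊂
  ... | X , Y , eq with split-at X D (sym eq)
  ...   | inj₁ (_ , D≡ , _) = ⊥-elim (absent X D-unmarked (λ ()) D≡)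
  ...   | inj₂ (X₂ , _ , eq′)
    with w , w∈ , _ , w≡hv ← anchored (map (mapᴮ g) bs) [] (run-cell≢[] (gap b))
           (map f (u ++ [ p ])) (map-snoc≢[] f u) X₂ (trans eq′ (sym (++-identityʳ _))) =
    same-letter f g u v (trans (cong (map g) (sym w≡))
      (trans (block-word g w∈ b∈ refl refl) w≡hv))

  -- The mirror image of `pinnedˡ`, obtained by reversing the text. The dictionary now comes after
  -- the blocks and plays the part of `E` in `anchored`.
  pinnedʳ : ∀ {b u p v} f g → b ∈ bs → word b ≡ u ++ p ∷ v →
    Infix _≡_ (map cell (map f (p ∷ v)) ++ run (gap b) ++ [ mark (lead b) ]) (text g) →
    g p ≡ f p
  pinnedʳ {b@(⟨ c , i , _ ⟩)} {u} {p} {v} f g b∈ refl s⊂ with X , Y , eq ← infix⁻ s⊂ =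
    let w , w∈ , _ , w≡hv = anchored (reverse (map mirror (map (mapᴮ g) bs)))
          reverse-unmarked D-starts (map f (reverse v ++ [ p ]))
          (map-snoc≢[] f (reverse v)) (reverse Y) (reversed X Y eq)
        b′ , b′∈ , mirrored = ∈-map⁻ mirror (Any.reverse⁻ w∈)
    in
    same-letter f g (reverse v) (reverse u) (begin
      map g (reverse v ++ p ∷ reverse u) ≡⟨ cong (map g) (reverse-split u) ⟨
      map g (reverse (u ++ p ∷ v))       ≡⟨ reverse-map g (u ++ p ∷ v) ⟩
      reverse (map g (u ++ p ∷ v))       ≡⟨ cong reverse
                                              (block-word g b′∈ b∈ (cong lead mirrored)
                                                (cong gap mirrored)) ⟩
      reverse (word b′)                  ≡⟨ cong word mirrored ⟨
      w                                  ≡⟨ w≡hv ⟩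
      map f (reverse v ++ [ p ]) ++ _    ∎)
    where
    open ≡-Reasoning
    reverse-unmarked : All NotMark (reverse D)
    reverse-unmarked = All.tabulate λ x∈ → All.lookup D-unmarked (Any.reverse⁻ x∈)
    -- The one false place for the window would be the first opening mark, with its cells in the
    -- dictionary. This needs a cell exactly `i` pads before the mark, but `D` ends in `M > i` pads.
    D-starts : ∀ d U → run i ++ cell d ∷ U ≢ reverse D
    D-starts d U eq = let D₀ , D≡ = D-ends in
      run-cell≢run (short-gaps b∈) d U (reverse D₀) (trans eq
        (trans (cong reverse D≡)
          (trans (reverse-++ D₀ (run M)) (cong (_++ reverse D₀) (reverse-run M)))))
    reversed : ∀ X Y →
      text g ≡ X ++ (map cell (map f (p ∷ v)) ++ run i ++ [ mark c ]) ++ Y →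
      reverse Y ++ mark c ∷ (run i ++ map cell (map f (reverse v ++ [ p ]))) ++ reverse X ≡
      renders (reverse (map mirror (map (mapᴮ g) bs))) ++ reverse D
    reversed X Y eq = begin
      reverse Y ++ mark c ∷ (run i ++ map cell (map f (reverse v ++ [ p ]))) ++ reverse X
        ≡⟨ cong (λ t → reverse Y ++ t ++ reverse X) anchor-reversed ⟨
      reverse Y ++ reverse anchor ++ reverse X
        ≡⟨ reverse-infix X anchor Y ⟨
      reverse (X ++ anchor ++ Y)
        ≡⟨ cong reverse eq ⟨
      reverse (D ++ renders (map (mapᴮ g) bs))
        ≡⟨ reverse-++ D _ ⟩
      reverse (renders (map (mapᴮ g) bs)) ++ reverse D
        ≡⟨ cong (_++ reverse D) (reverse-renders (map (mapᴮ g) bs)) ⟩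
      renders (reverse (map mirror (map (mapᴮ g) bs))) ++ reverse D
        ∎
      where
      anchor = map cell (map f (p ∷ v)) ++ run i ++ [ mark c ]
      anchor-reversed : reverse anchor ≡ mark c ∷ run i ++ map cell (map f (reverse v ++ [ p ]))
      anchor-reversed = begin
        reverse anchor
          ≡⟨ reverse-++ (map cell (map f (p ∷ v))) (run i ++ [ mark c ]) ⟩
        reverse (run i ++ [ mark c ]) ++ reverse (map cell (map f (p ∷ v)))
          ≡⟨ cong₂ _++_ (trans (reverse-++ (run i) [ mark c ]) (cong (mark c ∷_) (reverse-run i)))
               (trans (sym (reverse-map cell (map f (p ∷ v))))
                 (cong (map cell) (trans (sym (reverse-map f (p ∷ v)))
                   (cong (map f) (unfold-reverse p v))))) ⟩
        mark c ∷ run i ++ map cell (map f (reverse v ++ [ p ]))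
          ∎

  -- The window from the opening mark of its block up to `p` occurs in `text f`, hence in `text g`,
  -- and `pinnedˡ` applies.
  text-injective : ∀ f g → text f ≡ text g → ∀ p → f p ≡ g p
  text-injective f g eq p with b , b∈ , p∈ ← used p with u , v , w≡ ← ∈-∃++ p∈ =
    sym (pinnedˡ f g b∈ w≡ (subst (Infix _≡_ _) eq (D ++ⁱ infix-renders b∈ w≡)))
    where
    infix-renders : ∀ {b bs u v} → b ∈ bs → word b ≡ u ++ p ∷ v →
      Infix _≡_ (mark (lead b) ∷ run (gap b) ++ map cell (map f (u ++ [ p ])))
        (renders (map (mapᴮ f) bs))
    infix-renders {b} {u = u} {v} (here refl) refl =
      subst (λ t → Infix _≡_ (mark (lead b) ∷ front) (mark (lead b) ∷ t ++ [ mark (lead b) ]))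
        (sym body-split) (infix⁺ [] (mark (lead b) ∷ front) back ⁱ++ [ mark (lead b) ]) ⁱ++ _
      where
      open ≡-Reasoning
      front = run (gap b) ++ map cell (map f (u ++ [ p ]))
      back  = map cell (map f v) ++ run (gap b)
      body-split : body (mapᴮ f b) ≡ front ++ back
      body-split = begin
        run (gap b) ++ map cell (map f (u ++ p ∷ v)) ++ run (gap b)
          ≡⟨ cong (λ t → run (gap b) ++ map cell (map f t) ++ run (gap b)) (++-assoc u [ p ] v) ⟨
        run (gap b) ++ map cell (map f ((u ++ [ p ]) ++ v)) ++ run (gap b)
          ≡⟨ cong (λ t → run (gap b) ++ t ++ run (gap b))
               (trans (cong (map cell) (map-++ f (u ++ [ p ]) v))
                 (map-++ cell (map f (u ++ [ p ])) (map f v))) ⟩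
        run (gap b) ++ (map cell (map f (u ++ [ p ])) ++ map cell (map f v)) ++ run (gap b)
          ≡⟨ cong (run (gap b) ++_) (++-assoc (map cell (map f (u ++ [ p ]))) _ _) ⟩
        run (gap b) ++ map cell (map f (u ++ [ p ])) ++ back
          ≡⟨ ++-assoc (run (gap b)) _ _ ⟨
        front ++ back
          ∎
    infix-renders {bs = b ∷ _} (there b∈) w≡ = render (mapᴮ f b) ++ⁱ infix-renders b∈ w≡

  mixed : ∀ f g (t : List (Letter C (K ⊎ P))) → map (fill f) t ≡ map (fill g) t ⊎
    (∃[ u ] ∃[ p ] ∃[ v ] t ≡ u ++ cell (inj₂ p) ∷ v × f p ≢ g p)
  mixed f g [] = inj₁ refl
  mixed f g (l ∷ t) with mixed f g t
  ... | inj₂ (u , p , v , refl , f≢g) = inj₂ (l ∷ u , p , v , refl , f≢g)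
  mixed f g (pad ∷ t)           | inj₁ eq = inj₁ (cong (pad ∷_) eq)
  mixed f g (mark c ∷ t)        | inj₁ eq = inj₁ (cong (mark c ∷_) eq)
  mixed f g (cell (inj₁ d) ∷ t) | inj₁ eq = inj₁ (cong (cell d ∷_) eq)
  mixed f g (cell (inj₂ p) ∷ t) | inj₁ eq with f p ≟ g p
  ... | yes f≡g = inj₁ (cong₂ (λ d t → cell d ∷ t) f≡g eq)
  ... | no f≢g  = inj₂ ([] , p , t , refl , f≢g)

  -- Between the two marks of a block there is only its body, so a window around `p` that reaches
  -- neither mark lies inside that body.
  around : ∀ x t₁ p t₂ y → template ≡ x ++ (t₁ ++ cell (inj₂ p) ∷ t₂) ++ y →
    ∃[ b ] b ∈ bs × ∃[ u ] ∃[ v ] word b ≡ u ++ p ∷ v ×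
    ((∃[ e ] t₁ ≡ e ++ mark (lead b) ∷ run (gap b) ++ map cell (map inj₂ u)) ⊎
     (∃[ e ] t₂ ≡ (map cell (map inj₂ v) ++ run (gap b)) ++ mark (lead b) ∷ e) ⊎
     Infix _≡_ (t₁ ++ cell (inj₂ p) ∷ t₂) (body (mapᴮ inj₂ b)))
  around x t₁ p t₂ y eq
    with split-at (x ++ t₁) (map (mapᴸ inj₁) D) (trans (trans (++-assoc x t₁ _)
           (cong (x ++_) (sym (++-assoc t₁ (cell (inj₂ p) ∷ t₂) y)))) (sym eq))
  ... | inj₁ (_ , D≡ , _) = ⊥-elim (absent {Q = _≢ cell (inj₂ p)} (x ++ t₁)
          (All.map⁺ (All.universal (λ { pad () ; (mark _) () ; (cell _) () }) D))
          (λ ≢ → ≢ refl) D≡)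
  ... | inj₂ (X , x≡ , q)
    with _ , b∈ , u′ , v′ , w≡ , (Z , left) , (Z′ , right) ← locate (map (mapᴮ inj₂) bs) X q
    with b@(⟨ c , i , _ ⟩) , b∈bs , refl ← ∈-map⁻ (mapᴮ inj₂) b∈
    with u , _ , v , refl , refl , refl , refl ← map-split inj₂ (word b) u′ w≡ =
    b , b∈bs , u , v , refl , inside
    where
    before = run i ++ map cell (map inj₂ u)
    after  = map cell (map inj₂ v) ++ run i
    whole : ∀ e e′ → before ≡ e ++ t₁ → after ≡ t₂ ++ e′ →
      Infix _≡_ (t₁ ++ cell (inj₂ p) ∷ t₂) (body (mapᴮ inj₂ b))
    whole e e′ before≡ after≡ = subst (Infix _≡_ _) (begin
      e ++ (t₁ ++ cell (inj₂ p) ∷ t₂) ++ e′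
        ≡⟨ cong (e ++_) (++-assoc t₁ (cell (inj₂ p) ∷ t₂) e′) ⟩
      e ++ t₁ ++ cell (inj₂ p) ∷ t₂ ++ e′
        ≡⟨ ++-assoc e t₁ _ ⟨
      (e ++ t₁) ++ cell (inj₂ p) ∷ t₂ ++ e′
        ≡⟨ cong₂ (λ l r → l ++ cell (inj₂ p) ∷ r) before≡ after≡ ⟨
      before ++ cell (inj₂ p) ∷ after
        ≡⟨ ++-assoc (run i) (map cell (map inj₂ u)) _ ⟩
      run i ++ map cell (map inj₂ u) ++ map cell (map inj₂ (p ∷ v)) ++ run i
        ≡⟨ cong (run i ++_) (++-assoc (map cell (map inj₂ u)) _ (run i)) ⟨
      run i ++ (map cell (map inj₂ u) ++ map cell (map inj₂ (p ∷ v))) ++ run i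
        ≡⟨ cong (λ t → run i ++ t ++ run i) (trans (sym (map-++ cell (map inj₂ u) _))
             (cong (map cell) (sym (map-++ inj₂ u (p ∷ v))))) ⟩
      run i ++ map cell (map inj₂ (u ++ p ∷ v)) ++ run i
        ∎) (infix⁺ e (t₁ ++ cell (inj₂ p) ∷ t₂) e′)
      where open ≡-Reasoning
    inside : (∃[ e ] t₁ ≡ e ++ mark c ∷ before) ⊎
      (∃[ e ] t₂ ≡ after ++ mark c ∷ e) ⊎
      Infix _≡_ (t₁ ++ cell (inj₂ p) ∷ t₂) (body (mapᴮ inj₂ b))
    inside with clip-left x (map (mapᴸ inj₁) D ++ Z) (trans (trans x≡
                  (cong (map (mapᴸ inj₁) D ++_) left)) (sym (++-assoc (map (mapᴸ inj₁) D) Z _)))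
         | clip-right t₂ after (trans right (sym (++-assoc (map cell (map inj₂ v)) (run i) _)))
    ... | inj₁ l       | _             = inj₁ l
    ... | inj₂ _       | inj₁ r        = inj₂ (inj₁ r)
    ... | inj₂ (e , l) | inj₂ (e′ , r) = inj₂ (inj₂ (whole e e′ l r))

  fill-cells : ∀ f w → map (fill f) (map cell (map inj₂ w)) ≡ map cell (map f w)
  fill-cells f w = trans (map-cells [ id , f ]′ (map inj₂ w)) (cong (map cell) (sym (map-∘ w)))

  fill-anchorˡ : ∀ f c i w → map (fill f) (mark c ∷ run i ++ map cell (map inj₂ w)) ≡
    mark c ∷ run i ++ map cell (map f w)
  fill-anchorˡ f c i w = cong (mark c ∷_) (trans (map-++ (fill f) (run i) _)
    (cong₂ _++_ (map-replicate (fill f) i pad) (fill-cells f w)))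

  fill-anchorʳ : ∀ f c i w → map (fill f) (map cell (map inj₂ w) ++ run i ++ [ mark c ]) ≡
    map cell (map f w) ++ run i ++ [ mark c ]
  fill-anchorʳ f c i w = trans (map-++ (fill f) (map cell (map inj₂ w)) _)
    (cong₂ _++_ (fill-cells f w) (trans (map-++ (fill f) (run i) _)
      (cong (_++ [ mark c ]) (map-replicate (fill f) i pad))))

  left-anchor : ∀ c i u p e (t₂ : List (Letter C (K ⊎ P))) →
    Infix _≡_ (mark c ∷ run i ++ map cell (map inj₂ (u ++ [ p ])))
    ((e ++ mark c ∷ run i ++ map cell (map inj₂ u)) ++ cell (inj₂ p) ∷ t₂)
  left-anchor c i u p e t₂ = subst (Infix _≡_ _) (begin
    e ++ mark c ∷ (run i ++ map cell (map inj₂ (u ++ [ p ]))) ++ t₂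
      ≡⟨ cong (λ t → e ++ mark c ∷ (run i ++ t) ++ t₂)
           (trans (cong (map cell) (map-++ inj₂ u [ p ])) (map-++ cell (map inj₂ u) _)) ⟩
    e ++ mark c ∷ (run i ++ map cell (map inj₂ u) ++ [ cell (inj₂ p) ]) ++ t₂
      ≡⟨ cong (λ t → e ++ mark c ∷ t) (trans (cong (_++ t₂) (sym (++-assoc (run i) _ _)))
           (++-assoc (run i ++ map cell (map inj₂ u)) _ t₂)) ⟩
    e ++ (mark c ∷ run i ++ map cell (map inj₂ u)) ++ cell (inj₂ p) ∷ t₂
      ≡⟨ ++-assoc e _ _ ⟨
    (e ++ mark c ∷ run i ++ map cell (map inj₂ u)) ++ cell (inj₂ p) ∷ t₂
      ∎) (infix⁺ e (mark c ∷ run i ++ map cell (map inj₂ (u ++ [ p ]))) t₂)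
    where open ≡-Reasoning

  right-anchor : ∀ c i p v e (t₁ : List (Letter C (K ⊎ P))) →
    Infix _≡_ (map cell (map inj₂ (p ∷ v)) ++ run i ++ [ mark c ])
      (t₁ ++ cell (inj₂ p) ∷ (map cell (map inj₂ v) ++ run i) ++ mark c ∷ e)
  right-anchor c i p v e t₁ = subst (Infix _≡_ _)
    (cong (λ t → t₁ ++ cell (inj₂ p) ∷ t) (begin
      (map cell (map inj₂ v) ++ run i ++ [ mark c ]) ++ e
        ≡⟨ cong (_++ e) (++-assoc (map cell (map inj₂ v)) (run i) [ mark c ]) ⟨
      ((map cell (map inj₂ v) ++ run i) ++ [ mark c ]) ++ e
        ≡⟨ ++-assoc (map cell (map inj₂ v) ++ run i) [ mark c ] e ⟩
      (map cell (map inj₂ v) ++ run i) ++ mark c ∷ e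
        ∎)) (infix⁺ t₁ (map cell (map inj₂ (p ∷ v)) ++ run i ++ [ mark c ]) e)
    where open ≡-Reasoning

  -- An occurrence of `s` in `text f` must contain a cell where `f` and `g` differ, or `s` would
  -- occur at the same place in `text g`. It must also reach a mark of that block, or `s` would lie
  -- in the dictionary and hence in `text g`. That mark pins the letter at the differing cell.
  single-site : ∀ f g s → Infix _≡_ s (text f) → ¬ Infix _≡_ s (text g) →
    ∃[ p ] f p ≢ g p × (∀ h → Infix _≡_ s (text h) → h p ≡ f p)
  single-site f g s s⊂f s⊄g
    with X , Y , eq ← infix⁻ s⊂f
    with x , ty , tpl≡ , refl , ty≡ ← map-++⁻ (fill f) template X (trans (fill-template f) eq)
    with t , y , refl , refl , refl ← map-++⁻ (fill f) ty s (sym ty≡)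
    with mixed f g t
  ... | inj₁ same = ⊥-elim (s⊄g (subst₂ (Infix _≡_) (sym same)
          (trans (sym (trans (map-++ (fill g) x (t ++ y))
              (cong (map (fill g) x ++_) (map-++ (fill g) t y))))
            (trans (cong (map (fill g)) (sym tpl≡)) (fill-template g)))
          (infix⁺ (map (fill g) x) (map (fill g) t) (map (fill g) y))))
  ... | inj₂ (t₁ , p , t₂ , refl , f≢g)
    with around x t₁ p t₂ y tpl≡
  ... | b , b∈ , u , v , w≡ , inj₂ (inj₂ t⊂) = ⊥-elim (s⊄g
          (infix-trans (subst (Infix _≡_ _) (trans (map-body [ id , f ]′ (mapᴮ inj₂ b))
              (cong (λ w → body ⟨ lead b , gap b , w ⟩) (sym (map-∘ (word b)))))
            (infix-map (fill f) t⊂)) (covers f b∈ ⁱ++ _)))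
  ... | b , b∈ , u , v , w≡ , inj₁ (e , refl) = p , f≢g , λ h s⊂h →
          pinnedˡ f h b∈ w≡ (infix-trans

            -- The anchor, from the opening mark to `p`, is itself a substring of `s`, so every text
            -- containing `s` contains it.
            (infix-reflexive (sym (fill-anchorˡ f (lead b) (gap b) (u ++ [ p ]))))
            (infix-trans (infix-map (fill f) (left-anchor (lead b) (gap b) u p e t₂)) s⊂h))
  ... | b , b∈ , u , v , w≡ , inj₂ (inj₁ (e , refl)) = p , f≢g , λ h s⊂h →
          pinnedʳ f h b∈ w≡ (infix-trans

            (infix-reflexive (sym (fill-anchorʳ f (lead b) (gap b) (p ∷ v))))
            (infix-trans (infix-map (fill f) (right-anchor (lead b) (gap b) p v e t₁)) s⊂h))

-- The hard family for large alphabets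

length-cartesianProductWith : ∀ (f : A → B → C) xs ys →
  length (cartesianProductWith f xs ys) ≡ length xs * length ys
length-cartesianProductWith f []       ys = refl
length-cartesianProductWith f (x ∷ xs) ys = trans (length-++ (map (f x) ys))
  (cong₂ _+_ (length-map (f x) ys) (length-cartesianProductWith f xs ys))

length-concatMap-≤ : ∀ (f : A → List B) k xs → (∀ {x} → x ∈ xs → length (f x) ≤ k) →
  length (concatMap f xs) ≤ length xs * k
length-concatMap-≤ f k []       le = z≤n
length-concatMap-≤ f k (x ∷ xs) le = ≤-trans (≤-reflexive (length-++ (f x)))
  (+-mono-≤ (le (here refl)) (length-concatMap-≤ f k xs (le ∘ there)))

Parse-concatMap : ∀ (f : A → List B) k {past} xs →
  (∀ {x} more → x ∈ xs → Parse (past ++ more) (f x) k) → Parse past (concatMap f xs) (length xs * k)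
Parse-concatMap f k {past} xs each =
  subst (λ t → Parse t (concatMap f xs) (length xs * k)) (++-identityʳ past) (go [] xs each)
  where
  go : ∀ before xs → (∀ {x} more → x ∈ xs → Parse (past ++ more) (f x) k) →
    Parse (past ++ before) (concatMap f xs) (length xs * k)
  go before []       each = done
  go before (x ∷ xs) each = Parse-++ (each before (here refl))
    (subst (λ t → Parse t (concatMap f xs) (length xs * k)) (sym (++-assoc past before (f x)))
      (go (before ++ f x) xs (λ more → each more ∘ there)))

run-prefix : ∀ {i M} → i ≤ M → run {C} {H} i ++ run (M ∸ i) ≡ run M
run-prefix {i = i} {M} i≤M = trans (run-+ i (M ∸ i)) (cong run (m+[n∸m]≡n i≤M))

run-suffix : ∀ {i M} → i ≤ M → run {C} {H} (M ∸ i) ++ run i ≡ run M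
run-suffix {i = i} {M} i≤M = trans (run-+ (M ∸ i) i) (cong run (m∸n+n≡m i≤M))

infix-runs : ∀ {i M} → i ≤ M → ∀ (x : List (Letter C H)) →
  Infix _≡_ (run i ++ x ++ run i) (run M ++ x ++ run M)
infix-runs {i = i} {M} i≤M x = subst (Infix _≡_ _) (begin
  run (M ∸ i) ++ (run i ++ x ++ run i) ++ run (M ∸ i)
    ≡⟨ cong (run (M ∸ i) ++_) (trans (++-assoc (run i) (x ++ run i) _)
         (cong (run i ++_) (++-assoc x (run i) _))) ⟩
  run (M ∸ i) ++ run i ++ x ++ run i ++ run (M ∸ i)
    ≡⟨ ++-assoc (run (M ∸ i)) (run i) _ ⟨
  (run (M ∸ i) ++ run i) ++ x ++ run i ++ run (M ∸ i)
    ≡⟨ cong₂ (λ l r → l ++ x ++ r) (run-suffix i≤M) (run-prefix i≤M) ⟩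
  run M ++ x ++ run M
    ∎) (infix⁺ (run (M ∸ i)) (run i ++ x ++ run i) (run (M ∸ i)))
  where open ≡-Reasoning

pads-are-run : ∀ {w : List (Letter C H)} → All (_≡ pad) w → w ≡ run (length w)
pads-are-run []          = refl
pads-are-run (refl ∷ ps) = cong (pad ∷_) (pads-are-run ps)

module Family (γ l m r : ℕ) where

  L M positions : ℕ
  L = suc l
  M = suc m
  positions = γ * (M * L)

  blockAt : Fin γ → Fin M → Block (Fin γ) (Fin positions)
  blockAt c i = ⟨ c , toℕ i , tabulate (λ j → combine c (combine i j)) ⟩

  bs : List (Block (Fin γ) (Fin positions))
  bs = cartesianProductWith blockAt (allFin γ) (allFin M)

  length-bs : length bs ≡ γ * M
  length-bs = trans (length-cartesianProductWith blockAt (allFin γ) (allFin M))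
    (cong₂ _*_ (length-tabulate {n = γ} id) (length-tabulate {n = M} id))

  bs-rec : ∀ {b} → b ∈ bs → ∃[ c ] ∃[ i ] b ≡ blockAt c i
  bs-rec b∈ with c , i , _ , _ , b≡ ← ∈-cartesianProductWith⁻ blockAt (allFin γ) (allFin M) b∈ =
    c , i , b≡

  entry : List (Fin γ) → List (Letter (Fin γ) (Fin γ))
  entry w = run M ++ map cell w ++ run M

  entries : List (Letter (Fin γ) (Fin γ))
  entries = concatMap entry (words γ L)

  -- The first run makes every later run of `M` pads a single copy, the run of `r` pads adjusts the
  -- total length, and the last run separates the words from the first opening mark.
  D : List (Letter (Fin γ) (Fin γ))
  D = run M ++ run r ++ entries ++ run M

  D-unmarked : All NotMark D
  D-unmarked = All.++⁺ (run-NotMark M) (All.++⁺ (run-NotMark r)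
    (All.++⁺ (All.concat⁺ (All.map⁺ (All.universal entry-unmarked (words γ L)))) (run-NotMark M)))
    where
    entry-unmarked : ∀ w → All NotMark (entry w)
    entry-unmarked w = All.++⁺ (run-NotMark M)
      (All.++⁺ (All.map⁺ (All.universal (λ _ → cell) w)) (run-NotMark M))

  D-ends : ∃[ D₀ ] D ≡ D₀ ++ run M
  D-ends = run M ++ run r ++ entries , sym (trans (++-assoc (run M) _ _)
    (cong (run M ++_) (++-assoc (run r) entries (run M))))

  short-gaps : ∀ {b} → b ∈ bs → gap b < M
  short-gaps b∈ with c , i , refl ← bs-rec b∈ = Fin.toℕ<n i

  distinct : ∀ {b b′} → b ∈ bs → b′ ∈ bs → lead b ≡ lead b′ → gap b ≡ gap b′ → b ≡ b′
  distinct b∈ b′∈ lead≡ gap≡ with c , i , refl ← bs-rec b∈ | c′ , i′ , refl ← bs-rec b′∈ =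
    cong₂ blockAt lead≡ (Fin.toℕ-injective gap≡)

  word-length : ∀ {b} → b ∈ bs → length (word b) ≡ L
  word-length b∈ with c , i , refl ← bs-rec b∈ =
    length-tabulate {n = L} (λ j → combine c (combine i j))

  covers : ∀ {b} f → b ∈ bs → Infix _≡_ (body (mapᴮ f b)) D
  covers {b} f b∈ = infix-trans (infix-runs (<⇒≤ (short-gaps b∈)) (map cell (map f (word b))))
    (run M ++ⁱ (run r ++ⁱ (infix-concatMap entry w∈ ⁱ++ run M)))
    where
    w∈ : map f (word b) ∈ words γ L
    w∈ = subst (λ k → map f (word b) ∈ words γ k)
      (trans (length-map f (word b)) (word-length b∈)) (∈-words (map f (word b)))

  used : ∀ p → ∃[ b ] b ∈ bs × p ∈ word b
  used p with c , q , refl ← Fin.combine-surjective {γ} {M * L} p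
    with i , j , refl ← Fin.combine-surjective {M} {L} q =
    blockAt c i , ∈-cartesianProductWith⁺ blockAt (∈-allFin c) (∈-allFin i) ,
    ∈-tabulate⁺ {f = λ j → combine c (combine i j)} j

  open Hidden Fin._≟_ D M bs D-unmarked D-ends short-gaps distinct covers used public

  -- `k` pieces cut up the filler. An entry costs two copied runs and `L` literals; a block costs
  -- its two marks and one copy, since its whole body lies in the dictionary.
  phrases : ℕ → ℕ
  phrases k = (M + (k + (γ ^ L * (1 + (L + 1)) + 1))) + γ * M * 3

  Parse-text : ∀ f k → r ≤ k * M → Parse [] (text f) (phrases k)
  Parse-text f k r≤ = Parse-++ (Parse-++ start (Parse-++ padding (Parse-++
      (subst (Parse _ entries) (cong (_* (1 + (L + 1))) (length-words γ L))
        (Parse-concatMap entry (1 + (L + 1)) (words γ L) Parse-entry))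
      (Parse-copy (run-occurs (run r) ⁱ++ entries)))))
    (subst (Parse D (renders (map (mapᴮ f) bs)))
      (cong (_* 3) (trans (length-map (mapᴮ f) bs) length-bs))
      (Parse-concatMap render 3 (map (mapᴮ f) bs) Parse-render))
    where
    start : Parse [] (run {Fin γ} {Fin γ} M) M
    start = subst (Parse [] _) (length-replicate M) (Parse-literals (run M))
    padding : Parse (run M) (run {Fin γ} {Fin γ} r) k
    padding = Parse-chunks
      (λ w pads len → subst (λ t → Infix _≡_ t (run M)) (sym (pads-are-run pads))
        (subst (Infix _≡_ _) (run-prefix len) (infix-reflexive refl ⁱ++ run (M ∸ length w))))
      k (run r) (All.replicate⁺ r refl) (≤-trans (≤-reflexive (length-replicate r)) r≤)
    run-occurs : ∀ more → Infix _≡_ (run M) (run {Fin γ} {Fin γ} M ++ more)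
    run-occurs more = infix-reflexive refl ⁱ++ more
    Parse-entry : ∀ {w} more → w ∈ words γ L →
      Parse ((run M ++ run r) ++ more) (entry w) (1 + (L + 1))
    Parse-entry {w} more w∈ = Parse-++ (Parse-copy (run-occurs (run r) ⁱ++ more))
      (Parse-++ (subst (Parse _ (map cell w)) (trans (length-map cell w) (words-length L w∈))
          (Parse-literals (map cell w)))
        (Parse-copy (((run-occurs (run r) ⁱ++ more) ⁱ++ run M) ⁱ++ map cell w)))
    Parse-render : ∀ {b} more → b ∈ map (mapᴮ f) bs → Parse (D ++ more) (render b) 3
    Parse-render {b} more b∈ with b′ , b′∈ , refl ← ∈-map⁻ (mapᴮ f) b∈ =
      literal (copy (body b) ((covers f b′∈ ⁱ++ more) ⁱ++ [ mark (lead b) ]) (literal done))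

  length-entries : length entries ≡ γ ^ L * (M + (L + M))
  length-entries = trans (length-concatMap entry (M + (L + M)) (words γ L) λ {w} w∈ →
      trans (length-++ (run M)) (cong₂ _+_ (length-replicate M) (trans (length-++ (map cell w))
        (cong₂ _+_ (trans (length-map cell w) (words-length L w∈)) (length-replicate M)))))
    (cong (_* (M + (L + M))) (length-words γ L))

  length-renders : ∀ (f : Fin positions → Fin γ) →
    length (renders (map (mapᴮ f) bs)) ≡ length (renders bs)
  length-renders f = trans (cong length (sym (map-renders f bs))) (length-map (mapᴸ f) (renders bs))

  length-renders-≤ : length (renders bs) ≤ γ * M * (M + L + M)
  length-renders-≤ = ≤-trans (length-concatMap-≤ render (M + L + M) bs length-render)
    (≤-reflexive (cong (_* (M + L + M)) length-bs))
    where
    length-render : ∀ {b} → b ∈ bs → length (render b) ≤ M + L + M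
    length-render {b} b∈ = begin
      suc (length (body b ++ [ mark (lead b) ]))
        ≡⟨ cong suc (trans (length-++ (body b)) (+-comm (length (body b)) 1)) ⟩
      2 + length (body b)
        ≡⟨ cong (2 +_) (trans (length-++ (run (gap b))) (cong₂ _+_ (length-replicate (gap b))
             (trans (length-++ (map cell (word b))) (cong₂ _+_
               (trans (length-map cell (word b)) (word-length b∈))
               (length-replicate (gap b)))))) ⟩
      2 + (gap b + (L + gap b))
        ≡⟨ regroup (gap b) L ⟩
      (suc (gap b) + L) + suc (gap b)
        ≤⟨ +-mono-≤ (+-monoˡ-≤ L (short-gaps b∈)) (short-gaps b∈) ⟩
      M + L + M
        ∎
      where
      open ≤-Reasoning
      regroup : ∀ i L → 2 + (i + (L + i)) ≡ (suc i + L) + suc i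
      regroup = solve-∀

  length-text : ∀ f → length (text f) ≡ r + (M + (γ ^ L * (M + (L + M)) + M) + length (renders bs))
  length-text f = begin
    length (D ++ renders (map (mapᴮ f) bs))
      ≡⟨ trans (length-++ D) (cong₂ _+_ length-D (length-renders f)) ⟩
    M + (r + (γ ^ L * (M + (L + M)) + M)) + length (renders bs)
      ≡⟨ regroup M r _ (length (renders bs)) ⟩
    r + (M + (γ ^ L * (M + (L + M)) + M) + length (renders bs))
      ∎
    where
    open ≡-Reasoning
    regroup : ∀ M r x y → M + (r + x) + y ≡ r + (M + x + y)
    regroup = solve-∀
    length-D : length D ≡ M + (r + (γ ^ L * (M + (L + M)) + M))
    length-D = trans (length-++ (run M)) (cong₂ _+_ (length-replicate M)
      (trans (length-++ (run r)) (cong₂ _+_ (length-replicate r)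
        (trans (length-++ entries) (cong₂ _+_ length-entries (length-replicate M))))))

-- Coding marks, hidden letters and the pad into the alphabet

module Embedding {γ σ : ℕ} (2γ<σ : suc (γ + γ) ≤ σ) where

  code : Letter (Fin γ) (Fin γ) → Fin (suc (γ + γ))
  code pad      = zero
  code (mark c) = suc (join γ γ (inj₁ c))
  code (cell d) = suc (join γ γ (inj₂ d))

  join-injective : ∀ x y → join γ γ x ≡ join γ γ y → x ≡ y
  join-injective x y eq = trans (sym (Fin.splitAt-join γ γ x))
    (trans (cong (splitAt γ) eq) (Fin.splitAt-join γ γ y))

  code-injective : ∀ x y → code x ≡ code y → x ≡ y
  code-injective pad      pad      eq = refl
  code-injective (mark c) (mark d) eq
    with refl ← join-injective (inj₁ c) (inj₁ d) (Fin.suc-injective eq) = refl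
  code-injective (mark c) (cell d) eq
    with () ← join-injective (inj₁ c) (inj₂ d) (Fin.suc-injective eq)
  code-injective (cell c) (mark d) eq
    with () ← join-injective (inj₂ c) (inj₁ d) (Fin.suc-injective eq)
  code-injective (cell c) (cell d) eq
    with refl ← join-injective (inj₂ c) (inj₂ d) (Fin.suc-injective eq) = refl

  embed : Letter (Fin γ) (Fin γ) → Fin σ
  embed x = inject≤ (code x) 2γ<σ

  embed-injective : ∀ {x y} → embed x ≡ embed y → x ≡ y
  embed-injective {x} {y} eq = code-injective x y (Fin.inject≤-injective 2γ<σ 2γ<σ _ _ eq)

  infix-embed⁻ : ∀ {s t} → Infix _≡_ (map embed s) (map embed t) → Infix _≡_ s t
  infix-embed⁻ {s} {t} s⊂t with u , s≡u , u⊂t ← infix-map⁻ embed t s⊂t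
    with refl ← map-injective embed-injective s≡u = u⊂t

-- Since `32 ≤ γ ^ 5`, the bound is `γ ^ (6 + 4 * L)`, and `L ≥ 1` absorbs the constant.
power-bound : ∀ {γ M n} L → 2 ≤ γ → 1 ≤ L → n ≤ 32 * γ * M * M → M ≤ γ ^ L * γ ^ L →
  n ≤ γ ^ (10 * L)
power-bound {γ} {M} {n} L 2≤γ 1≤L n≤ M≤ = begin
  n
    ≤⟨ n≤ ⟩
  32 * γ * M * M
    ≤⟨ *-mono-≤ (*-mono-≤ (*-monoˡ-≤ γ (^-monoˡ-≤ 5 2≤γ)) M≤) M≤ ⟩
  γ ^ 5 * γ * (γ ^ L * γ ^ L) * (γ ^ L * γ ^ L)
    ≡⟨ regroup γ (γ ^ L) ⟩
  γ ^ 6 * (γ ^ L) ^ 4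
    ≡⟨ cong (γ ^ 6 *_) (^-*-assoc γ L 4) ⟩
  γ ^ 6 * γ ^ (L * 4)
    ≡⟨ ^-distribˡ-+-* γ 6 (L * 4) ⟨
  γ ^ (6 + L * 4)
    ≤⟨ ^-monoʳ-≤ γ {{>-nonZero (≤-trans (s≤s z≤n) 2≤γ)}}
         (+-monoˡ-≤ (L * 4) (*-monoˡ-≤ 6 1≤L)) ⟩
  γ ^ (L * 6 + L * 4)
    ≡⟨ cong (γ ^_) (trans (sym (*-distribˡ-+ L 6 4)) (*-comm L 10)) ⟩
  γ ^ (10 * L)
    ∎
  where
  open ≤-Reasoning
  regroup : ∀ γ x → γ * (γ * (γ * (γ * (γ * 1)))) * γ * (x * x) * (x * x) ≡
    γ * (γ * (γ * (γ * (γ * (γ * 1))))) * (x * (x * (x * (x * 1))))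
  regroup = solve-∀

-- Here `9600 = 10 * 24 * 40`, and `g = γ - 1` is the number of exclusions at each of the
-- `γ * (M * L)` positions.
budget : ∀ {σ g γ M q z} L → σ ≤ 24 * g → z ≤ 40 * (γ * M) → γ * (M * L) * g ≤ q →
  10 * L * (σ * z) ≤ 9600 * q
budget {σ} {g} {γ} {M} {q} {z} L σ≤ z≤ q≥ = begin
  10 * L * (σ * z)                   ≤⟨ *-monoʳ-≤ (10 * L) (*-mono-≤ σ≤ z≤) ⟩
  10 * L * (24 * g * (40 * (γ * M))) ≡⟨ regroup L g γ M ⟩
  9600 * (γ * (M * L) * g)           ≤⟨ *-monoʳ-≤ 9600 q≥ ⟩
  9600 * q                           ∎
  where
  open ≤-Reasoning
  regroup : ∀ L g γ M → 10 * L * (24 * g * (40 * (γ * M))) ≡ 9600 * (γ * (M * L) * g)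
  regroup = solve-∀

-- Parameters and conclusion for large alphabets

module LargeAlphabet {g σ n : ℕ} (1≤g : 1 ≤ g)
  (8γ≤σ : 8 * suc g ≤ σ) (σ≤24g : σ ≤ 24 * g) (σ≤n : σ ≤ n) where

  γ : ℕ
  γ = suc g

  -- M = m + 1 is to be the largest number with 8 γ M² ≤ n, and L = l + 1 the
  -- largest one with γ^(L-1) L ≤ M.
  block-growth : ℕ → ℕ
  block-growth m = 8 * γ * (suc m * suc m)

  word-growth : ℕ → ℕ
  word-growth l = γ ^ l * suc l

  letters-fit : suc (γ + γ) ≤ σ
  letters-fit = ≤-trans (m≤m+n _ _) (≤-trans (≤-reflexive (split g)) 8γ≤σ)
    where
    split : ∀ g → suc (suc g + suc g) + (5 + 6 * g) ≡ 8 * suc g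
    split = solve-∀

  2≤γ : 2 ≤ γ
  2≤γ = s≤s 1≤g

  suc≤word-growth : ∀ l → suc l ≤ word-growth l
  suc≤word-growth l = m≤n*m (suc l) (γ ^ l) {{m^n≢0 γ l}}

  module _ (l m : ℕ) (M-fits : block-growth m ≤ n) (M-largest : n < block-growth (suc m))
    (L-fits : word-growth l ≤ suc m) (L-largest : suc m < word-growth (suc l)) where

    -- The blocks are the same for every filler length, so taking them from the family with filler
    -- `0` lets the true filler `n ∸ base` be defined without circularity.
    base : ℕ
    base = M + (γ ^ L * (M + (L + M)) + M) + length (renders bs)
      where open Family γ l m 0

    open Family γ l m (n ∸ base)

    L≤M : L ≤ M
    L≤M = ≤-trans (suc≤word-growth l) L-fits

    γ^l≤M : γ ^ l ≤ M
    γ^l≤M = ≤-trans (m≤m*n (γ ^ l) L) L-fits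

    -- In units of `γ * M²` the two outer runs take 1, the runs of the entries 2, their words 1 and
    -- the blocks 3. The dictionary is bounded through `γ ^ L = γ * γ ^ l` and `γ ^ l * L ≤ M`.
    base≤n : base ≤ n
    base≤n = begin
      M + (γ ^ L * (M + (L + M)) + M) + length (renders bs)
        ≤⟨ +-monoʳ-≤ (M + (γ ^ L * (M + (L + M)) + M)) length-renders-≤ ⟩
      M + (γ ^ L * (M + (L + M)) + M) + γ * M * (M + L + M)
        ≡⟨ regroup M γ (γ ^ l) L ⟩
      2 * M * 1 + γ * (γ ^ l) * (2 * M) + γ * (γ ^ l * L) * 1 + γ * M * (2 * M + L)
        ≤⟨ +-mono-≤ (+-mono-≤ (+-mono-≤
             (*-mono-≤ (*-monoˡ-≤ M 2≤γ) 1≤M)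
             (*-monoˡ-≤ (2 * M) (*-monoʳ-≤ γ γ^l≤M)))
             (*-mono-≤ (*-monoʳ-≤ γ L-fits) 1≤M))
             (*-monoʳ-≤ (γ * M) (+-monoʳ-≤ (2 * M) L≤M)) ⟩
      γ * M * M + γ * M * (2 * M) + γ * M * M + γ * M * (2 * M + M)
        ≡⟨ collect γ M ⟩
      7 * γ * (M * M)
        ≤⟨ *-monoˡ-≤ (M * M) (*-monoˡ-≤ γ (n≤1+n 7)) ⟩
      8 * γ * (M * M)
        ≤⟨ M-fits ⟩
      n ∎
      where
      open ≤-Reasoning
      1≤M : 1 ≤ M
      1≤M = s≤s z≤n
      regroup : ∀ M γ x L → M + (γ * x * (M + (L + M)) + M) + γ * M * (M + L + M) ≡
        2 * M * 1 + γ * x * (2 * M) + γ * (x * L) * 1 + γ * M * (2 * M + L)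
      regroup = solve-∀
      collect : ∀ γ M → γ * M * M + γ * M * (2 * M) + γ * M * M + γ * M * (2 * M + M) ≡
        7 * γ * (M * M)
      collect = solve-∀

    open Embedding {γ} letters-fit

    -- Maximality of `M` together with `M + 1 ≤ 2 * M`, which turns `8` into `32`.
    n≤32γM² : n ≤ 32 * γ * M * M
    n≤32γM² = begin
      n                                 ≤⟨ <⇒≤ M-largest ⟩
      8 * γ * (suc M * suc M)           ≤⟨ *-monoʳ-≤ (8 * γ) (*-mono-≤ sM sM) ⟩
      8 * γ * ((M + M) * (M + M))       ≡⟨ regroup γ M ⟩
      32 * γ * M * M                    ∎
      where
      open ≤-Reasoning
      sM : suc M ≤ M + M
      sM = +-monoˡ-≤ M (s≤s z≤n)
      regroup : ∀ γ M → 8 * γ * ((M + M) * (M + M)) ≡ 32 * γ * M * M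
      regroup = solve-∀

    S : Vec (Fin γ) positions → String σ
    S v = map embed (text (lookup v))

    length-S : ∀ v → length (S v) ≡ n
    length-S v = trans (length-map embed (text (lookup v)))
      (trans (length-text (lookup v)) (m∸n+n≡m base≤n))

    -- In units of `γ * M`: 1 for the first run, 1 for the last, 2 for the runs of the entries, 1
    -- for their words, 32 for the filler, whose length is at most `n`, and 3 for the blocks.
    few-phrases : ∀ v → z-no (S v) ≤ 40 * (γ * M)
    few-phrases v = begin
      z-no (S v)
        ≤⟨ z-no≤ (Parse-map embed (Parse-text (lookup v) (32 * γ * M)
             (≤-trans (m∸n≤m n base) n≤32γM²))) ⟩
      phrases (32 * γ * M)
        ≡⟨ regroup M γ (γ ^ l) L ⟩
      1 * M + 1 * 1 + (2 * (γ * γ ^ l) + γ * (γ ^ l * L) + 35 * (γ * M))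
        ≤⟨ +-mono-≤ (+-mono-≤ (*-monoˡ-≤ M 1≤γ) (*-mono-≤ 1≤γ 1≤M))
             (+-monoˡ-≤ (35 * (γ * M))
               (+-mono-≤ (*-monoʳ-≤ 2 (*-monoʳ-≤ γ γ^l≤M)) (*-monoʳ-≤ γ L-fits))) ⟩
      γ * M + γ * M + (2 * (γ * M) + γ * M + 35 * (γ * M))
        ≡⟨ collect (γ * M) ⟩
      40 * (γ * M) ∎
      where
      open ≤-Reasoning
      1≤γ : 1 ≤ γ
      1≤γ = s≤s z≤n
      1≤M : 1 ≤ M
      1≤M = s≤s z≤n
      regroup : ∀ M γ x L → (M + (32 * γ * M + (γ * x * (1 + (L + 1)) + 1))) + γ * M * 3 ≡
        1 * M + 1 * 1 + (2 * (γ * x) + γ * (x * L) + 35 * (γ * M))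
      regroup = solve-∀
      collect : ∀ x → x + x + (2 * x + x + 35 * x) ≡ 40 * x
      collect = solve-∀

    S-injective : ∀ v w → S v ≡ S w → ∀ p → lookup v p ≡ lookup w p
    S-injective v w eq = text-injective (lookup v) (lookup w)
      (map-injective {f = embed} embed-injective {text (lookup v)} {text (lookup w)} eq)

    -- A query that occurs in a coded text is itself the code of a string of `Letter`s, so the
    -- uncoded statement applies to its preimage.
    S-single-site : ∀ s v w → s SubstringOf S v → ¬ s SubstringOf S w →
      ∃[ p ] lookup v p ≢ lookup w p × (∀ u → s SubstringOf S u → lookup u p ≡ lookup v p)
    S-single-site s v w s⊂ s⊄ =
      let t , s≡ , t⊂ = infix-map⁻ embed (text (lookup v)) s⊂
          p , differ , forced = single-site (lookup v) (lookup w) t t⊂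
            λ t⊂w → s⊄ (subst (_SubstringOf S w) (sym s≡) (infix-map embed t⊂w))
      in p , differ , λ u s⊂u → forced (lookup u)
           (infix-embed⁻ (subst (_SubstringOf S u) s≡ s⊂u))

    full : Box γ positions
    full _ = record { extra = g ; letter = id ; injective = id }

    n≤σ^ : n ≤ σ ^ (10 * L)
    n≤σ^ = begin
      n              ≤⟨ power-bound L 2≤γ (s≤s z≤n) n≤32γM² M≤ ⟩
      γ ^ (10 * L)   ≤⟨ ^-monoˡ-≤ (10 * L) (≤-trans (m≤n*m γ 8) 8γ≤σ) ⟩
      σ ^ (10 * L)   ∎
      where
      open ≤-Reasoning
      M≤ : M ≤ γ ^ L * γ ^ L
      M≤ = ≤-trans (<⇒≤ L-largest) (*-monoʳ-≤ (γ ^ L) (n<b^n 2≤γ L))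

    lower-bound-at : (A : Algorithm σ) → Reconstructs A n →
      ∃[ T ] (length T ≡ n × (σ * z-no T) *log⟨ σ ⟩ n ≼ (9600 * queries A T))
    lower-bound-at A correct =
      let v , _ , many = adversary S S-injective S-single-site A full
            (λ v _ → correct (S v) (length-S v))
      in S v , length-S v , log-≼ {{>-nonZero (≤-trans (s≤s z≤n) 8γ≤σ)}} (10 * L) n≤σ^
        (budget {g = g} {γ} {M} L σ≤24g (few-phrases v)
          (≤-trans (≤-reflexive (sym (∑-const positions g))) many))

  lower-bound : (A : Algorithm σ) → Reconstructs A n →
    ∃[ T ] (length T ≡ n × (σ * z-no T) *log⟨ σ ⟩ n ≼ (9600 * queries A T))
  lower-bound =
    let m , M-fits , M-largest = largest block-growth m≤block-growth n first-fits
        l , L-fits , L-largest = largest word-growth (λ l → <⇒≤ (suc≤word-growth l))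
          (suc m) (s≤s z≤n)
    in lower-bound-at l m M-fits M-largest L-fits L-largest
    where
    m≤block-growth : ∀ m → m ≤ block-growth m
    m≤block-growth m = begin
      m                   ≤⟨ n≤1+n m ⟩
      suc m               ≤⟨ m≤m*n (suc m) (suc m) ⟩
      suc m * suc m       ≤⟨ m≤n*m (suc m * suc m) (8 * γ) ⟩
      block-growth m      ∎
      where open ≤-Reasoning
    first-fits : block-growth 0 ≤ n
    first-fits = ≤-trans (≤-reflexive (*-identityʳ (8 * γ))) (≤-trans 8γ≤σ σ≤n)

theorem3 : ∃[ C ] ∃[ n₀ ] ((σ n : ℕ) → 2 ≤ σ → σ ≤ n → n₀ ≤ n →
    (A : Algorithm σ) → Reconstructs A n →
    ∃[ S ] (length S ≡ n × (σ * z-no S) *log⟨ σ ⟩ n ≼ (C * queries A S)))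
-- `9600` comes from large alphabets and exceeds the `240` of small ones; `n ≥ 32` ensures
-- `2 * σ ≤ n` when `σ ≤ 16`.
theorem3 = 9600 , 32 , bound
  where
  bound : (σ n : ℕ) → 2 ≤ σ → σ ≤ n → 32 ≤ n →
    (A : Algorithm σ) → Reconstructs A n →
    ∃[ S ] (length S ≡ n × (σ * z-no S) *log⟨ σ ⟩ n ≼ (9600 * queries A S))
  bound σ n 2≤σ σ≤n 32≤n A correct with σ ≤? 16
  ... | yes σ≤16 =
    let S , len , log≼ = SmallAlphabet.lower-bound 2≤σ
          (≤-trans (*-monoʳ-≤ 2 σ≤16) 32≤n) σ≤16 A correct
    in S , len , ≤-trans log≼ (^-monoʳ-≤ σ {{>-nonZero (≤-trans (s≤s z≤n) 2≤σ)}}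
         (*-monoˡ-≤ (queries A S) (m≤m+n 240 9360)))
  -- With `γ = σ / 8`, the bound `16 < σ` gives `γ ≥ 2`, hence `g ≥ 1`. Moreover `8 * γ ≤ σ ≤ n` is
  -- what lets `M = 1` fit, and rounding gives `σ ≤ 16 + 8 * g ≤ 24 * g`.
  ... | no σ≰16 = large (σ / 8) (/-monoˡ-≤ 8 (<⇒≤ (≰⇒> σ≰16)))
      (≤-trans (≤-reflexive (*-comm 8 (σ / 8))) (m/n*n≤m σ 8))
      (≤-trans (≤-reflexive (m≡m%n+[m/n]*n σ 8))
        (+-monoˡ-≤ (σ / 8 * 8) (<⇒≤ (m%n<n σ 8))))
    where
    large : ∀ γ → 2 ≤ γ → 8 * γ ≤ σ → σ ≤ 8 + γ * 8 →
      ∃[ S ] (length S ≡ n × (σ * z-no S) *log⟨ σ ⟩ n ≼ (9600 * queries A S))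
    large (suc g) (s≤s 1≤g) 8γ≤σ σ< =
      LargeAlphabet.lower-bound 1≤g 8γ≤σ σ≤24g σ≤n A correct
      where
      σ≤24g : σ ≤ 24 * g
      σ≤24g = begin
        σ               ≤⟨ σ< ⟩
        16 * 1 + g * 8  ≤⟨ +-monoˡ-≤ (g * 8) (*-monoʳ-≤ 16 1≤g) ⟩
        16 * g + g * 8  ≡⟨ cong (16 * g +_) (*-comm g 8) ⟩
        16 * g + 8 * g  ≡⟨ *-distribʳ-+ g 16 8 ⟨
        24 * g          ∎
        where open ≤-Reasoning
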